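{- Let $p$ be an odd prime, let $s,t\in\mathbb{N}$ with $s,t\ge 2$, and let $G\in\mathfrak{B}_{p,2,n}$, where $n\ge s\cdot t^4$. Then $G$ has either an abelian subgroup $S\le G$ such that $S[G,G]/[G,G]\cong\mathbb{Z}_p^s$, or a subgroup isomorphic to $F_{p,2,t}$.
   Context: Let $p$ be an odd prime. $\mathfrak{B}_{p,2}$ is the class of finite groups $G$ such that the commutator subgroup $[G,G]$ is contained in the centre $\mathrm{Z}(G)$ and every $g\in G$ satisfies $g^p=\mathrm{id}$. $\mathfrak{B}_{p,2,n}\subseteq\mathfrak{B}_{p,2}$ consists of those $G\in\mathfrak{B}_{p,2}$ whose minimal generating sets have size $n$, equivalently $G/[G,G]\cong\mathbb{Z}_p^n$, where $\mathbb{Z}_p$ is the cyclic group of order $p$. $F_{p,2,t}$ denotes the relatively free $p$-group of class $2$ and exponent $p$ with $t$ generators, i.e. the quotient of the free group on $t$ generators by the subgroup generated by all words of the form $x^p$ and $[[x,y],z]$ (with $x,y,z$ ranging over all elements of the free group). -}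

module Defs where

open import Algebra.Bundles using (Group)
open import Algebra.Morphism.Structures using (module GroupMorphisms)
import Algebra.Construct.Pointwise as Pointwise
import Algebra.Definitions
import Algebra.Definitions.RawMonoid as RawMonoidDefinitions
import Algebra.Properties.Group as GroupProperties
open import Data.Fin.Base using (Fin)
open import Data.Integer.Base using (+_)
import Data.Integer.Divisibility.Signed as ℤ
import Data.Integer.Properties as ℤ
open import Data.Nat.Base using (ℕ; zero; suc)
open import Data.Product.Base using (Σ; ∃; ∃-syntax; _×_; _,_; proj₁; proj₂)
open import Data.Sum.Base using (_⊎_; inj₁; inj₂)
open import Function.Base using (_on_)
open import Function.Bundles using (Inverse)
open import Level using (Level; _⊔_; 0ℓ) renaming (suc to lsuc)
open import Relation.Binary.Bundles using (Setoid)
open import Relation.Binary.PropositionalEquality.Core using (subst)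
open import Relation.Binary.PropositionalEquality.Properties using (setoid)
import Relation.Binary.Reasoning.Setoid as SetoidReasoning
open import Relation.Unary using (Pred; _⊆_)

private
  variable
    a c ℓ c′ ℓ′ m m′ : Level

Finite : Setoid c ℓ → Set (c ⊔ ℓ)
Finite S = ∃[ N ] Inverse S (setoid (Fin N))

infix 4 _≅_
_≅_ : Group c ℓ → Group c′ ℓ′ → Set (c ⊔ ℓ ⊔ c′ ⊔ ℓ′)
G ≅ H = ∃ IsGroupIsomorphism
  where open GroupMorphisms (Group.rawGroup G) (Group.rawGroup H)

record Subgroup (G : Group c ℓ) (m : Level) : Set (c ⊔ ℓ ⊔ lsuc m) where
  open Group G
  field
    Mem       : Pred Carrier m
    resp      : ∀ {x y} → x ≈ y → Mem x → Mem y
    ε-closed  : Mem ε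
    ∙-closed  : ∀ {x y} → Mem x → Mem y → Mem (x ∙ y)
    ⁻¹-closed : ∀ {x} → Mem x → Mem (x ⁻¹)

-- The subgroup as a group in its own right: membership proofs are ignored
-- by the equality.
⌊_⌋ : {G : Group c ℓ} → Subgroup G m → Group (c ⊔ m) ℓ
⌊_⌋ {G = G} H = record
  { Carrier = Σ Carrier Mem
  ; _≈_     = _≈_ on proj₁
  ; _∙_     = λ (x , x∈) (y , y∈) → x ∙ y , ∙-closed x∈ y∈
  ; ε       = ε , ε-closed
  ; _⁻¹     = λ (x , x∈) → x ⁻¹ , ⁻¹-closed x∈
  ; isGroup = record
    { isMonoid = record
      { isSemigroup = record
        { isMagma = record
          { isEquivalence = record { refl = refl ; sym = sym ; trans = trans }
          ; ∙-cong        = ∙-cong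
          }
        ; assoc = λ x y z → assoc (proj₁ x) (proj₁ y) (proj₁ z)
        }
      ; identity = (λ x → identityˡ (proj₁ x)) , (λ x → identityʳ (proj₁ x))
      }
    ; inverse = (λ x → inverseˡ (proj₁ x)) , (λ x → inverseʳ (proj₁ x))
    ; ⁻¹-cong = ⁻¹-cong
    }
  }
  where open Group G; open Subgroup H

Abelian : Group c ℓ → Set (c ⊔ ℓ)
Abelian G = Commutative _∙_
  where open Group G; open Algebra.Definitions _≈_

record NormalSubgroup (G : Group c ℓ) (m : Level) : Set (c ⊔ ℓ ⊔ lsuc m) where
  open Group G
  field
    subgroup : Subgroup G m
  open Subgroup subgroup public
  field
    normal : ∀ g {x} → Mem x → Mem (g ∙ x ∙ g ⁻¹)

-- G / N has the elements of G, with x equal to y when x ∙ y ⁻¹ ∈ N.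
module Quotient {G : Group c ℓ} (N : NormalSubgroup G m) where
  open Group G
  open GroupProperties G
  open SetoidReasoning (Group.setoid G)
  open NormalSubgroup N

  _∼_ : Carrier → Carrier → Set m
  x ∼ y = Mem (x ∙ y ⁻¹)

  ≈⇒∼ : ∀ {x y} → x ≈ y → x ∼ y
  ≈⇒∼ x≈y = resp (sym (x≈y⇒x∙y⁻¹≈ε x≈y)) ε-closed

  ∼-sym : ∀ {x y} → x ∼ y → y ∼ x
  ∼-sym {x} {y} p = resp (⁻¹-anti-homo-// x y) (⁻¹-closed p)

  ∼-trans : ∀ {x y z} → x ∼ y → y ∼ z → x ∼ z
  ∼-trans {x} {y} {z} p q = resp eq (∙-closed p q)
    where
    eq : (x ∙ y ⁻¹) ∙ (y ∙ z ⁻¹) ≈ x ∙ z ⁻¹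
    eq = begin
      (x ∙ y ⁻¹) ∙ (y ∙ z ⁻¹)  ≈⟨ assoc x (y ⁻¹) (y ∙ z ⁻¹) ⟩
      x ∙ (y ⁻¹ ∙ (y ∙ z ⁻¹))  ≈⟨ ∙-congˡ (\\-leftDividesʳ y (z ⁻¹)) ⟩
      x ∙ z ⁻¹                 ∎

  ∼-∙-cong : ∀ {x y u v} → x ∼ y → u ∼ v → (x ∙ u) ∼ (y ∙ v)
  ∼-∙-cong {x} {y} {u} {v} p q = resp eq (∙-closed (normal x q) p)
    where
    eq : (x ∙ (u ∙ v ⁻¹) ∙ x ⁻¹) ∙ (x ∙ y ⁻¹) ≈ (x ∙ u) ∙ (y ∙ v) ⁻¹
    eq = begin
      (x ∙ (u ∙ v ⁻¹) ∙ x ⁻¹) ∙ (x ∙ y ⁻¹)  ≈⟨ assoc _ (x ⁻¹) (x ∙ y ⁻¹) ⟩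
      x ∙ (u ∙ v ⁻¹) ∙ (x ⁻¹ ∙ (x ∙ y ⁻¹))  ≈⟨ ∙-congˡ (\\-leftDividesʳ x (y ⁻¹)) ⟩
      x ∙ (u ∙ v ⁻¹) ∙ y ⁻¹                 ≈⟨ ∙-congʳ (assoc x u (v ⁻¹)) ⟨
      x ∙ u ∙ v ⁻¹ ∙ y ⁻¹                   ≈⟨ assoc (x ∙ u) (v ⁻¹) (y ⁻¹) ⟩
      x ∙ u ∙ (v ⁻¹ ∙ y ⁻¹)                 ≈⟨ ∙-congˡ (⁻¹-anti-homo-∙ y v) ⟨
      (x ∙ u) ∙ (y ∙ v) ⁻¹                  ∎

  ∼-⁻¹-cong : ∀ {x y} → x ∼ y → (x ⁻¹) ∼ (y ⁻¹)
  ∼-⁻¹-cong {x} {y} p = resp eq (normal (x ⁻¹) (∼-sym p))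
    where
    eq : x ⁻¹ ∙ (y ∙ x ⁻¹) ∙ x ⁻¹ ⁻¹ ≈ x ⁻¹ ∙ y ⁻¹ ⁻¹
    eq = begin
      x ⁻¹ ∙ (y ∙ x ⁻¹) ∙ x ⁻¹ ⁻¹    ≈⟨ assoc (x ⁻¹) (y ∙ x ⁻¹) (x ⁻¹ ⁻¹) ⟩
      x ⁻¹ ∙ ((y ∙ x ⁻¹) ∙ x ⁻¹ ⁻¹)  ≈⟨ ∙-congˡ (//-rightDividesʳ (x ⁻¹) y) ⟩
      x ⁻¹ ∙ y                       ≈⟨ ∙-congˡ (⁻¹-involutive y) ⟨
      x ⁻¹ ∙ y ⁻¹ ⁻¹                 ∎

infixl 7 _/_
_/_ : (G : Group c ℓ) → NormalSubgroup G m → Group c m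
G / N = record
  { Carrier = Carrier
  ; _≈_     = _∼_
  ; _∙_     = _∙_
  ; ε       = ε
  ; _⁻¹     = _⁻¹
  ; isGroup = record
    { isMonoid = record
      { isSemigroup = record
        { isMagma = record
          { isEquivalence = record { refl = ≈⇒∼ refl ; sym = ∼-sym ; trans = ∼-trans }
          ; ∙-cong        = ∼-∙-cong
          }
        ; assoc = λ x y z → ≈⇒∼ (assoc x y z)
        }
      ; identity = (λ x → ≈⇒∼ (identityˡ x)) , (λ x → ≈⇒∼ (identityʳ x))
      }
    ; inverse = (λ x → ≈⇒∼ (inverseˡ x)) , (λ x → ≈⇒∼ (inverseʳ x))
    ; ⁻¹-cong = ∼-⁻¹-cong
    }
  }
  where open Group G; open Quotient N

module Conjugation (G : Group c ℓ) where
  open Group G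
  open GroupProperties G
  open SetoidReasoning (Group.setoid G)

  conj : Carrier → Carrier → Carrier
  conj g x = g ∙ x ∙ g ⁻¹

  conj-ε : ∀ g → conj g ε ≈ ε
  conj-ε g = trans (∙-congʳ (identityʳ g)) (inverseʳ g)

  conj-∙ : ∀ g x y → conj g (x ∙ y) ≈ conj g x ∙ conj g y
  conj-∙ g x y = sym (begin
    (g ∙ x ∙ g ⁻¹) ∙ (g ∙ y ∙ g ⁻¹)    ≈⟨ assoc (g ∙ x) (g ⁻¹) _ ⟩
    g ∙ x ∙ (g ⁻¹ ∙ (g ∙ y ∙ g ⁻¹))    ≈⟨ ∙-congˡ (∙-congˡ (assoc g y (g ⁻¹))) ⟩
    g ∙ x ∙ (g ⁻¹ ∙ (g ∙ (y ∙ g ⁻¹)))  ≈⟨ ∙-congˡ (\\-leftDividesʳ g (y ∙ g ⁻¹)) ⟩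
    g ∙ x ∙ (y ∙ g ⁻¹)                 ≈⟨ assoc (g ∙ x) y (g ⁻¹) ⟨
    g ∙ x ∙ y ∙ g ⁻¹                   ≈⟨ ∙-congʳ (assoc g x y) ⟩
    g ∙ (x ∙ y) ∙ g ⁻¹                 ∎)

  conj-cong : ∀ g {x y} → x ≈ y → conj g x ≈ conj g y
  conj-cong g x≈y = ∙-congʳ (∙-congˡ x≈y)

  conj-⁻¹ : ∀ g x → conj g (x ⁻¹) ≈ conj g x ⁻¹
  conj-⁻¹ g x = inverseˡ-unique _ _ (begin
    conj g (x ⁻¹) ∙ conj g x  ≈⟨ conj-∙ g (x ⁻¹) x ⟨
    conj g (x ⁻¹ ∙ x)         ≈⟨ conj-cong g (inverseˡ x) ⟩
    conj g ε                  ≈⟨ conj-ε g ⟩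
    ε                         ∎)

module _ {G : Group c ℓ} where
  open Group G
  open GroupProperties G
  open SetoidReasoning (Group.setoid G)

  Mem-product : Subgroup G m → NormalSubgroup G m′ → Pred Carrier (c ⊔ ℓ ⊔ m ⊔ m′)
  Mem-product H N x = ∃[ h ] ∃[ k ] Subgroup.Mem H h × NormalSubgroup.Mem N k × x ≈ h ∙ k

  infixl 7 _·_
  _·_ : Subgroup G m → NormalSubgroup G m′ → Subgroup G (c ⊔ ℓ ⊔ m ⊔ m′)
  H · N = record
    { Mem       = Mem-product H N
    ; resp      = λ { x≈y (h , k , h∈ , k∈ , eq) → h , k , h∈ , k∈ , trans (sym x≈y) eq }
    ; ε-closed  = ε , ε , H.ε-closed , N.ε-closed , sym (identityˡ ε)
    ; ∙-closed  = λ { (h , k , h∈ , k∈ , eq) (h′ , k′ , h′∈ , k′∈ , eq′) →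
        h ∙ h′ , h′ ⁻¹ ∙ k ∙ h′ ∙ k′ , H.∙-closed h∈ h′∈ ,
        N.∙-closed (conj⁻¹ h′ k∈) k′∈ ,
        trans (∙-cong eq eq′) (∙-eq h k h′ k′) }
    ; ⁻¹-closed = λ { (h , k , h∈ , k∈ , eq) →
        h ⁻¹ , h ∙ k ⁻¹ ∙ h ⁻¹ , H.⁻¹-closed h∈ , N.normal h (N.⁻¹-closed k∈) ,
        trans (⁻¹-cong eq) (⁻¹-eq h k) }
    }
    where
    module H = Subgroup H
    module N = NormalSubgroup N

    conj⁻¹ : ∀ g {x} → N.Mem x → N.Mem (g ⁻¹ ∙ x ∙ g)
    conj⁻¹ g x∈ = N.resp (∙-congˡ (⁻¹-involutive g)) (N.normal (g ⁻¹) x∈)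

    ∙-eq : ∀ h k h′ k′ → (h ∙ k) ∙ (h′ ∙ k′) ≈ (h ∙ h′) ∙ (h′ ⁻¹ ∙ k ∙ h′ ∙ k′)
    ∙-eq h k h′ k′ = begin
      (h ∙ k) ∙ (h′ ∙ k′)                     ≈⟨ assoc h k (h′ ∙ k′) ⟩
      h ∙ (k ∙ (h′ ∙ k′))                     ≈⟨ ∙-congˡ (assoc k h′ k′) ⟨
      h ∙ (k ∙ h′ ∙ k′)                       ≈⟨ ∙-congˡ (\\-leftDividesˡ h′ (k ∙ h′ ∙ k′)) ⟨
      h ∙ (h′ ∙ (h′ ⁻¹ ∙ (k ∙ h′ ∙ k′)))      ≈⟨ assoc h h′ _ ⟨
      (h ∙ h′) ∙ (h′ ⁻¹ ∙ (k ∙ h′ ∙ k′))      ≈⟨ ∙-congˡ (assoc (h′ ⁻¹) (k ∙ h′) k′) ⟨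
      (h ∙ h′) ∙ (h′ ⁻¹ ∙ (k ∙ h′) ∙ k′)      ≈⟨ ∙-congˡ (∙-congʳ (assoc (h′ ⁻¹) k h′)) ⟨
      (h ∙ h′) ∙ (h′ ⁻¹ ∙ k ∙ h′ ∙ k′)        ∎

    ⁻¹-eq : ∀ h k → (h ∙ k) ⁻¹ ≈ h ⁻¹ ∙ (h ∙ k ⁻¹ ∙ h ⁻¹)
    ⁻¹-eq h k = begin
      (h ∙ k) ⁻¹                    ≈⟨ ⁻¹-anti-homo-∙ h k ⟩
      k ⁻¹ ∙ h ⁻¹                   ≈⟨ \\-leftDividesʳ h (k ⁻¹ ∙ h ⁻¹) ⟨
      h ⁻¹ ∙ (h ∙ (k ⁻¹ ∙ h ⁻¹))    ≈⟨ ∙-congˡ (assoc h (k ⁻¹) (h ⁻¹)) ⟨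
      h ⁻¹ ∙ (h ∙ k ⁻¹ ∙ h ⁻¹)      ∎

  data Generated (P : Pred Carrier m) : Pred Carrier (c ⊔ ℓ ⊔ m) where
    gen  : ∀ {x} → P x → Generated P x
    resp : ∀ {x y} → x ≈ y → Generated P x → Generated P y
    unit : Generated P ε
    mul  : ∀ {x y} → Generated P x → Generated P y → Generated P (x ∙ y)
    inv  : ∀ {x} → Generated P x → Generated P (x ⁻¹)

  ⟨_⟩ : Pred Carrier m → Subgroup G (c ⊔ ℓ ⊔ m)
  ⟨ P ⟩ = record
    { Mem = Generated P ; resp = resp ; ε-closed = unit ; ∙-closed = mul ; ⁻¹-closed = inv }

  -- A subgroup generated by a conjugation-invariant set is normal.
  ⟨_⟩-normal : (P : Pred Carrier m) → (∀ g {x} → P x → P (g ∙ x ∙ g ⁻¹)) →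
               NormalSubgroup G (c ⊔ ℓ ⊔ m)
  ⟨ P ⟩-normal closed = record { subgroup = ⟨ P ⟩ ; normal = go }
    where
    open Conjugation G
    go : ∀ g {x} → Generated P x → Generated P (conj g x)
    go g (gen x∈)       = gen (closed g x∈)
    go g (resp x≈y x∈)  = resp (conj-cong g x≈y) (go g x∈)
    go g unit           = resp (sym (conj-ε g)) unit
    go g (mul x∈ y∈)    = resp (sym (conj-∙ g _ _)) (mul (go g x∈) (go g y∈))
    go g (inv x∈)       = resp (sym (conj-⁻¹ g _)) (inv (go g x∈))

module GroupTheory (G : Group c ℓ) where
  open Group G
  open SetoidReasoning (Group.setoid G)
  open Conjugation G

  infix 9 [_,_]
  [_,_] : Carrier → Carrier → Carrier
  [ x , y ] = x ⁻¹ ∙ y ⁻¹ ∙ x ∙ y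

  infixl 8 _^_
  _^_ : Carrier → ℕ → Carrier
  g ^ n = n ⋆ g
    where open RawMonoidDefinitions rawMonoid using () renaming (_×_ to _⋆_)

  [,]-cong : ∀ {x y u v} → x ≈ y → u ≈ v → [ x , u ] ≈ [ y , v ]
  [,]-cong p q = ∙-cong (∙-cong (∙-cong (⁻¹-cong p) (⁻¹-cong q)) p) q

  conj-[,] : ∀ g x y → conj g [ x , y ] ≈ [ conj g x , conj g y ]
  conj-[,] g x y = begin
    conj g (x ⁻¹ ∙ y ⁻¹ ∙ x ∙ y)
      ≈⟨ conj-∙ g _ y ⟩
    conj g (x ⁻¹ ∙ y ⁻¹ ∙ x) ∙ conj g y
      ≈⟨ ∙-congʳ (conj-∙ g _ x) ⟩
    conj g (x ⁻¹ ∙ y ⁻¹) ∙ conj g x ∙ conj g y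
      ≈⟨ ∙-congʳ (∙-congʳ (conj-∙ g (x ⁻¹) (y ⁻¹))) ⟩
    conj g (x ⁻¹) ∙ conj g (y ⁻¹) ∙ conj g x ∙ conj g y
      ≈⟨ ∙-congʳ (∙-congʳ (∙-cong (conj-⁻¹ g x) (conj-⁻¹ g y))) ⟩
    [ conj g x , conj g y ] ∎

  conj-^ : ∀ g x n → conj g (x ^ n) ≈ conj g x ^ n
  conj-^ g x zero    = conj-ε g
  conj-^ g x (suc n) = trans (conj-∙ g x (x ^ n)) (∙-congˡ (conj-^ g x n))

  IsCommutator : Pred Carrier (c ⊔ ℓ)
  IsCommutator w = ∃[ x ] ∃[ y ] w ≈ [ x , y ]

  IsClassTwoExponentRelator : ℕ → Pred Carrier (c ⊔ ℓ)
  IsClassTwoExponentRelator p w =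
    (∃[ x ] w ≈ x ^ p) ⊎ (∃[ x ] ∃[ y ] ∃[ z ] w ≈ [ [ x , y ] , z ])

  Centre : Pred Carrier (c ⊔ ℓ)
  Centre g = ∀ x → g ∙ x ≈ x ∙ g

  derived : NormalSubgroup G (c ⊔ ℓ)
  derived = ⟨ IsCommutator ⟩-normal λ { g (x , y , eq) →
    conj g x , conj g y , trans (conj-cong g eq) (conj-[,] g x y) }

  classTwoExponentSubgroup : ℕ → NormalSubgroup G (c ⊔ ℓ)
  classTwoExponentSubgroup p = ⟨ IsClassTwoExponentRelator p ⟩-normal λ
    { g (inj₁ (x , eq)) → inj₁ (conj g x , trans (conj-cong g eq) (conj-^ g x p))
    ; g (inj₂ (x , y , z , eq)) → inj₂ (conj g x , conj g y , conj g z ,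
        trans (conj-cong g eq)
          (trans (conj-[,] g [ x , y ] z) ([,]-cong (conj-[,] g x y) refl))) }

open GroupTheory using (derived; classTwoExponentSubgroup)

-- N ∩ H as a normal subgroup of H.
infixl 7 _∩_
_∩_ : {G : Group c ℓ} → NormalSubgroup G m → (H : Subgroup G m′) → NormalSubgroup ⌊ H ⌋ m
N ∩ H = record
  { subgroup = record
    { Mem       = λ x → N.Mem (proj₁ x)
    ; resp      = N.resp
    ; ε-closed  = N.ε-closed
    ; ∙-closed  = N.∙-closed
    ; ⁻¹-closed = N.⁻¹-closed
    }
  ; normal = λ g → N.normal (proj₁ g)
  }
  where module N = NormalSubgroup N

ℤ-group : Group 0ℓ 0ℓ
ℤ-group = record { isGroup = ℤ.+-0-isGroup }

-- The cyclic group of order p.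
ℤ/ : ℕ → Group 0ℓ 0ℓ
ℤ/ p = ℤ-group / pℤ
  where
  module +-0 = Group ℤ-group
  open GroupProperties ℤ-group

  pℤ : NormalSubgroup ℤ-group 0ℓ
  pℤ = record
    { subgroup = record
      { Mem       = λ k → + p ℤ.∣ k
      ; resp      = λ k≡l → subst (+ p ℤ.∣_) k≡l
      ; ε-closed  = ℤ.divides (+ 0) +-0.refl
      ; ∙-closed  = ℤ.∣m∣n⇒∣m+n
      ; ⁻¹-closed = ℤ.∣m⇒∣-m
      }
    ; normal = λ g {x} → subst (+ p ℤ.∣_)
        (+-0.sym (+-0.trans (+-0.∙-congʳ (ℤ.+-comm g x)) (//-rightDividesʳ g x)))
    }

infix 8 _^ᴳ_
_^ᴳ_ : Group c ℓ → ℕ → Group c ℓ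
G ^ᴳ n = Pointwise.group (Fin n) G

-- The free group on A: group terms over A modulo the congruence generated by
-- the group axioms.
module Free (A : Set a) where

  infixl 7 _∙_
  infix 8 _⁻¹
  infix 4 _≈_

  data Term : Set a where
    var : A → Term
    ε   : Term
    _∙_ : Term → Term → Term
    _⁻¹ : Term → Term

  data _≈_ : Term → Term → Set a where
    refl      : ∀ {x} → x ≈ x
    sym       : ∀ {x y} → x ≈ y → y ≈ x
    trans     : ∀ {x y z} → x ≈ y → y ≈ z → x ≈ z
    ∙-cong    : ∀ {x y u v} → x ≈ y → u ≈ v → x ∙ u ≈ y ∙ v
    ⁻¹-cong   : ∀ {x y} → x ≈ y → x ⁻¹ ≈ y ⁻¹
    assoc     : ∀ x y z → (x ∙ y) ∙ z ≈ x ∙ (y ∙ z)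
    identityˡ : ∀ x → ε ∙ x ≈ x
    identityʳ : ∀ x → x ∙ ε ≈ x
    inverseˡ  : ∀ x → x ⁻¹ ∙ x ≈ ε
    inverseʳ  : ∀ x → x ∙ x ⁻¹ ≈ ε

  group : Group a a
  group = record
    { Carrier = Term
    ; _≈_     = _≈_
    ; _∙_     = _∙_
    ; ε       = ε
    ; _⁻¹     = _⁻¹
    ; isGroup = record
      { isMonoid = record
        { isSemigroup = record
          { isMagma = record
            { isEquivalence = record { refl = refl ; sym = sym ; trans = trans }
            ; ∙-cong        = ∙-cong
            }
          ; assoc = assoc
          }
        ; identity = identityˡ , identityʳ
        }
      ; inverse = inverseˡ , inverseʳ
      ; ⁻¹-cong = ⁻¹-cong
      }
    }

FreeGroup : Set a → Group a a
FreeGroup = Free.group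

F[_,2,_] : ℕ → ℕ → Group 0ℓ 0ℓ
F[ p ,2, t ] = FreeGroup (Fin t) / classTwoExponentSubgroup (FreeGroup (Fin t)) p

record 𝔅 (p : ℕ) (G : Group c ℓ) : Set (c ⊔ ℓ) where
  open Group G using (_≈_; ε) renaming (setoid to G-setoid)
  open GroupTheory G using (Centre; _^_)
  field
    finite      : Finite G-setoid
    derived⊆Z   : NormalSubgroup.Mem (derived G) ⊆ Centre
    exponent    : ∀ g → g ^ p ≈ ε

-- The abelianisation being ℤ_p^n is equivalent to the minimal generating sets
-- of G having size n.
record 𝔅ₙ (p n : ℕ) (G : Group c ℓ) : Set (c ⊔ ℓ) where
  field
    in-𝔅            : 𝔅 p G
    abelianisation  : (G / derived G) ≅ (ℤ/ p ^ᴳ n)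

_[G,G]/[G,G] : {G : Group c ℓ} → Subgroup G m → Group (c ⊔ ℓ ⊔ m) (c ⊔ ℓ)
_[G,G]/[G,G] {G = G} S = ⌊ S · derived G ⌋ / (derived G ∩ (S · derived G))

{-# OPTIONS --safe #-}
-- Let A = G/[G,G], and call x low if its centraliser has index at most k = p^d
-- in A. Greedily collect commuting elements, independent modulo [G,G], whose
-- centralisers have index at most k²; reaching s of them gives the abelian
-- subgroup. If the process stops at j < s elements, two low elements in the
-- same coset of the common centraliser U have a quotient in U of centraliser
-- index at most k², hence in the span of the chosen elements, so there are at
-- most (k²p)^j low elements. A union bound then chooses u₁, …, u_t one at a time
-- so that no nontrivial combination of them is low and all their commutators
-- are independent: for x not low, few u solve [x,u] = w. Since a relation in
-- the normal form ∏ uᵢ^aᵢ ∏ [uᵢ,uⱼ]^eᵢⱼ would make ∏ uᵢ^aᵢ central, independence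
-- of the commutators alone makes ⟨u₁, …, u_t⟩ relatively free.
-- The count needs only n ≥ (2d + 1)s with d = 1 + t(t - 1)/2.
module Submission where

open import Defs
open import Algebra.Bundles using (Group)
open import Algebra.Core using (Op₂)
open import Algebra.Morphism.Structures using (module GroupMorphisms)
import Algebra.Properties.CommutativeMonoid.Sum as CommutativeMonoidSum
import Algebra.Properties.Group as GroupProperties
import Algebra.Properties.Semiring.Sum as SemiringSum
open import Algebra.Structures using (IsGroup)
open import Data.Bool.Base using (if_then_else_)
open import Data.Fin.Base as Fin using (Fin; zero; suc; toℕ; fromℕ<; funToFin; finToFun)
open import Data.Fin.Properties as Fin
  using (any?; toℕ<n; toℕ-fromℕ<; toℕ-injective; funToFin-finToFin; finToFun-funToFin)
open import Data.Integer as ℤ using (ℤ)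
import Data.Integer.Divisibility.Signed as ℤ∣
import Data.Integer.DivMod as ℤ
import Data.Integer.Properties as ℤ
open import Data.List as List using (List; []; _∷_; length; upTo; cartesianProductWith)
open import Data.List.Membership.Propositional using (_∈_; lose)
open import Data.List.Membership.Propositional.Properties using (∈-cartesianProductWith⁺; ∈-upTo⁺)
open import Data.List.Properties using (length-upTo; length-++; length-map)
open import Data.List.Relation.Unary.Any as Any using (here; there)
open import Data.Nat as ℕ
  using (ℕ; zero; suc; _+_; _*_; _∸_; _≤_; _<_; _≥_; z≤n; s≤s; NonZero; _≤?_) renaming (_^_ to _^ℕ_)
open import Data.Nat.Coprimality using (coprime-Bézout)
open import Data.Nat.Divisibility using (_∣_; divides; _∣?_; ∣-refl; ∣⇒≤; ∣n∣m%n⇒∣m)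
open import Data.Nat.DivMod as ℕ using (_%_; m≡m%n+[m/n]*n; m%n<n; %-remove-+ˡ; [m+kn]%n≡m%n)
open import Data.Nat.GCD using (module Bézout)
open import Data.Nat.Primality using (Prime; prime⇒nonZero; prime⇒nonTrivial; prime⇒irreducible)
open import Data.Nat.Properties as ℕ using ()
open import Data.Nat.Tactic.RingSolver using (solve-∀)
open import Data.Product using (∃; ∃-syntax; Σ-syntax; _×_; _,_; proj₁; proj₂)
open import Data.Sum using (_⊎_; inj₁; inj₂; [_,_]′)
open import Data.Unit.Base using (tt)
open import Data.Vec as Vec using (Vec; []; _∷_; replicate; zipWith; tabulate; lookup)
open import Data.Vec.Properties
  using (map-++; map-∘; tabulate-∘; tabulate∘lookup; lookup∘tabulate; lookup-map; lookup-zipWith;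
         lookup-replicate; zipWith-comm)
open import Data.Vec.Relation.Unary.All as All using (All; []; _∷_)
import Data.Vec.Relation.Unary.All.Properties as All
open import Data.Vec.Relation.Unary.AllPairs as AllPairs using (AllPairs; []; _∷_)
open import Function.Base using (_∘_; case_of_)
open import Function.Bundles using (Inverse)
open import Level using (Level; _⊔_; Lift; lift)
open import Relation.Binary.Bundles using (Setoid)
open import Relation.Binary.Core using (Rel)
open import Relation.Binary.Definitions using (_Respects_)
open import Relation.Binary.PropositionalEquality as ≡ using (_≡_; cong; cong₂; subst)
import Relation.Binary.Reasoning.Setoid as SetoidReasoning
open import Relation.Nullary
  using (¬_; Dec; yes; no; does; contradiction; ¬?; _×-dec_; _⊎-dec_; decidable-stable)
open import Relation.Unary using (Pred; Decidable)

open CommutativeMonoidSum ℕ.+-0-commutativeMonoid using (sum; ∑-comm; ∑-distrib-+; sum-cong-≗)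
open SemiringSum ℕ.+-*-semiring using (*-distribʳ-sum)

-- The commutator induces an alternating bilinear map on A, a group of order N = p^n, and all
-- counting takes place there: the centraliser of x in A is the kernel of u ↦ [x,u]. No index is
-- ever computed: "index at most k" is the inequality N ≤ k * |C|, and arguments by cosets are
-- replaced by one double-counting inequality for products xy. The constants come from the choice of
-- the (m+1)-st element, m < t. There are p^(m(m+1)/2) coefficient vectors for a relation among the
-- commutators, each with at most N/k solutions; d = 1 + t(t - 1)/2 is the least exponent that keeps
-- their total at most p^(n-1) at every stage. There are p^(m+1) combinations, each low for at most
-- as many choices as there are low elements, that is at most p^((2d+1)(s-1)); n ≥ (2d + 1)s keeps
-- this total at most p^(n-1) as well. Two such sets do not cover A because p > 2.

private
  variable
    a b c ℓ c′ ℓ′ ℓ₁ ℓ₂ ℓ₃ : Level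
    m n : ℕ

-- Only the operation and the unit are parameters, so that powers and
-- combinations in a group and in its quotients agree definitionally.
module Combination {C : Set a} (_∙_ : Op₂ C) (ε : C) where

  pow : C → ℕ → C
  pow g zero    = ε
  pow g (suc n) = g ∙ pow g n

  lin : Vec ℕ n → Vec C n → C
  lin []       []       = ε
  lin (k ∷ ks) (g ∷ gs) = pow g k ∙ lin ks gs

-- Powers and linear combinations

module Powers (G : Group c ℓ) where
  open Group G
  open GroupProperties G
  open SetoidReasoning (Group.setoid G)
  open Combination _∙_ ε public

  pow≡^ : ∀ g n → pow g n ≡ GroupTheory._^_ G g n
  pow≡^ g zero    = ≡.refl
  pow≡^ g (suc n) = cong (g ∙_) (pow≡^ g n)

  pow-cong : ∀ n {x y} → x ≈ y → pow x n ≈ pow y n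
  pow-cong zero    x≈y = refl
  pow-cong (suc n) x≈y = ∙-cong x≈y (pow-cong n x≈y)

  pow-ε : ∀ n → pow ε n ≈ ε
  pow-ε zero    = refl
  pow-ε (suc n) = trans (identityˡ _) (pow-ε n)

  pow-+ : ∀ g m n → pow g (m + n) ≈ pow g m ∙ pow g n
  pow-+ g zero    n = sym (identityˡ _)
  pow-+ g (suc m) n = trans (∙-congˡ (pow-+ g m n)) (sym (assoc _ _ _))

  pow-* : ∀ g m n → pow g (m * n) ≈ pow (pow g n) m
  pow-* g zero    n = refl
  pow-* g (suc m) n = trans (pow-+ g n (m * n)) (∙-congˡ (pow-* g m n))

  Commute : Carrier → Carrier → Set ℓ
  Commute x y = x ∙ y ≈ y ∙ x

  swap-middle : ∀ w {x y} z → Commute x y → (w ∙ x) ∙ (y ∙ z) ≈ (w ∙ y) ∙ (x ∙ z)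
  swap-middle w {x} {y} z xy≈yx = begin
    (w ∙ x) ∙ (y ∙ z)  ≈⟨ assoc w x _ ⟩
    w ∙ (x ∙ (y ∙ z))  ≈⟨ ∙-congˡ (assoc x y z) ⟨
    w ∙ ((x ∙ y) ∙ z)  ≈⟨ ∙-congˡ (∙-congʳ xy≈yx) ⟩
    w ∙ ((y ∙ x) ∙ z)  ≈⟨ ∙-congˡ (assoc y x z) ⟩
    w ∙ (y ∙ (x ∙ z))  ≈⟨ assoc w y _ ⟨
    (w ∙ y) ∙ (x ∙ z)  ∎

  commute-ε : ∀ x → Commute x ε
  commute-ε x = trans (identityʳ x) (sym (identityˡ x))

  commute-∙ : ∀ {x y z} → Commute x y → Commute x z → Commute x (y ∙ z)
  commute-∙ {x} {y} {z} xy xz = begin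
    x ∙ (y ∙ z)  ≈⟨ assoc x y z ⟨
    (x ∙ y) ∙ z  ≈⟨ ∙-congʳ xy ⟩
    (y ∙ x) ∙ z  ≈⟨ assoc y x z ⟩
    y ∙ (x ∙ z)  ≈⟨ ∙-congˡ xz ⟩
    y ∙ (z ∙ x)  ≈⟨ assoc y z x ⟨
    (y ∙ z) ∙ x  ∎

  commute-pow : ∀ {x y} n → Commute x y → Commute x (pow y n)
  commute-pow zero    xy = commute-ε _
  commute-pow (suc n) xy = commute-∙ xy (commute-pow n xy)

  pow-∙ : ∀ {x y} n → Commute x y → pow (x ∙ y) n ≈ pow x n ∙ pow y n
  pow-∙ zero    xy = sym (identityˡ ε)
  pow-∙ (suc n) xy = trans (∙-congˡ (pow-∙ n xy)) (swap-middle _ _ (commute-pow n (sym xy)))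

  lin-++ : (ks : Vec ℕ m) (ls : Vec ℕ n) (gs : Vec Carrier m) (hs : Vec Carrier n) →
           lin (ks Vec.++ ls) (gs Vec.++ hs) ≈ lin ks gs ∙ lin ls hs
  lin-++ []       ls []       hs = sym (identityˡ _)
  lin-++ (k ∷ ks) ls (g ∷ gs) hs = trans (∙-congˡ (lin-++ ks ls gs hs)) (sym (assoc _ _ _))

  lin-zero : (gs : Vec Carrier n) → lin (replicate n 0) gs ≈ ε
  lin-zero []       = refl
  lin-zero (g ∷ gs) = trans (identityˡ _) (lin-zero gs)

  commute-lin : ∀ {x} (ks : Vec ℕ n) {gs} → All (Commute x) gs → Commute x (lin ks gs)
  commute-lin []       []         = commute-ε _
  commute-lin (k ∷ ks) (xg ∷ xgs) = commute-∙ (commute-pow k xg) (commute-lin ks xgs)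

  lin-+ : (ks ls : Vec ℕ n) {gs : Vec Carrier n} → AllPairs Commute gs →
          lin (zipWith _+_ ks ls) gs ≈ lin ks gs ∙ lin ls gs
  lin-+ []       []       {[]}     []         = sym (identityˡ ε)
  lin-+ (k ∷ ks) (l ∷ ls) {g ∷ gs} (gg ∷ ggs) = begin
    pow g (k + l) ∙ lin (zipWith _+_ ks ls) gs         ≈⟨ ∙-cong (pow-+ g k l) (lin-+ ks ls ggs) ⟩
    (pow g k ∙ pow g l) ∙ (lin ks gs ∙ lin ls gs)
      ≈⟨ swap-middle _ _ (sym (commute-pow l (sym (commute-lin ks gg)))) ⟩
    (pow g k ∙ lin ks gs) ∙ (pow g l ∙ lin ls gs)      ∎

  lin-* : ∀ k (ls : Vec ℕ n) {gs : Vec Carrier n} → AllPairs Commute gs →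
          lin (Vec.map (k *_) ls) gs ≈ pow (lin ls gs) k
  lin-* k []       {[]}     []         = sym (pow-ε k)
  lin-* k (l ∷ ls) {g ∷ gs} (gg ∷ ggs) = begin
    pow g (k * l) ∙ lin (Vec.map (k *_) ls) gs  ≈⟨ ∙-cong (pow-* g k l) (lin-* k ls ggs) ⟩
    pow (pow g l) k ∙ pow (lin ls gs) k
      ≈⟨ pow-∙ k (sym (commute-pow l (sym (commute-lin ls gg)))) ⟨
    pow (pow g l ∙ lin ls gs) k                 ∎

-- Linear algebra modulo p in groups of exponent p

bézout : ∀ {p k} → Prime p → ¬ p ∣ k → Bézout.Identity 1 k p
bézout {p} {k} p-prime p∤k = coprime-Bézout λ {d} (d∣k , d∣p) → case prime⇒irreducible p-prime d∣p of λ
  { (inj₁ d≡1) → d≡1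
  ; (inj₂ d≡p) → contradiction (subst (_∣ k) d≡p d∣k) p∤k }

module Exponent (G : Group c ℓ) {p : ℕ} (prime : Prime p)
                (pow-p : ∀ g → Group._≈_ G (Powers.pow G g p) (Group.ε G)) where
  open Group G
  open GroupProperties G
  open SetoidReasoning (Group.setoid G)
  open Powers G

  private instance
    p≢0 : NonZero p
    p≢0 = prime⇒nonZero prime

  pow-*p : ∀ g q → pow g (q * p) ≈ ε
  pow-*p g q = trans (pow-* g q p) (trans (pow-cong q (pow-p g)) (pow-ε q))

  pow-∣ : ∀ g {k} → p ∣ k → pow g k ≈ ε
  pow-∣ g (divides q ≡.refl) = pow-*p g q

  pow-% : ∀ g k → pow g (k % p) ≈ pow g k
  pow-% g k = begin
    pow g (k % p)                            ≈⟨ identityʳ _ ⟨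
    pow g (k % p) ∙ ε                        ≈⟨ ∙-congˡ (pow-*p g (k ℕ./ p)) ⟨
    pow g (k % p) ∙ pow g ((k ℕ./ p) * p)      ≈⟨ pow-+ g (k % p) _ ⟨
    pow g (k % p + (k ℕ./ p) * p)              ≡⟨ cong (pow g) (m≡m%n+[m/n]*n k p) ⟨
    pow g k                                  ∎

  -- Coefficients are natural numbers throughout, so multiplication by `p ∸ 1` plays the part of
  -- negation.
  pow-p∸1 : ∀ g → pow g (p ∸ 1) ≈ g ⁻¹
  pow-p∸1 g = inverseʳ-unique g _ (trans (reflexive (cong (pow g) (ℕ.suc-pred p))) (pow-p g))

  -- k is invertible modulo p, so g is a power of gᵏ.
  root : ∀ {k} → ¬ p ∣ k → ∃[ r ] (∀ g → pow (pow g k) r ≈ g)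
  root {k} p∤k with bézout prime p∤k
  ... | Bézout.+- x y eq = x , λ g → begin
    pow (pow g k) x          ≈⟨ pow-* g x k ⟨
    pow g (x * k)            ≡⟨ cong (pow g) eq ⟨
    g ∙ pow g (y * p)        ≈⟨ ∙-congˡ (pow-*p g y) ⟩
    g ∙ ε                    ≈⟨ identityʳ g ⟩
    g                        ∎
  -- Here 1 + x * k is a multiple of p, so x inverts k only up to sign; the factor `p ∸ 1` corrects
  -- the sign.
  ... | Bézout.-+ x y eq = (p ∸ 1) * x , λ g → begin
    pow (pow g k) ((p ∸ 1) * x)    ≈⟨ pow-* (pow g k) (p ∸ 1) x ⟩
    pow (pow (pow g k) x) (p ∸ 1)  ≈⟨ pow-p∸1 _ ⟩
    pow (pow g k) x ⁻¹             ≈⟨ ⁻¹-cong (pow-* g x k) ⟨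
    pow g (x * k) ⁻¹               ≈⟨ inverseˡ-unique g _ (trans (reflexive (cong (pow g) eq)) (pow-*p g y)) ⟨
    g                              ∎

  pow-injective : ∀ {k} → ¬ p ∣ k → ∀ {x y} → pow x k ≈ pow y k → x ≈ y
  pow-injective p∤k {x} {y} eq with r , root-r ← root p∤k =
    trans (sym (root-r x)) (trans (pow-cong r eq) (root-r y))

  lin-∣ : {ks : Vec ℕ n} (gs : Vec Carrier n) → All (p ∣_) ks → lin ks gs ≈ ε
  lin-∣ []       []           = refl
  lin-∣ (g ∷ gs) (p∣k ∷ p∣ks) = trans (∙-cong (pow-∣ g p∣k) (lin-∣ gs p∣ks)) (identityˡ ε)

  lin-% : (ks : Vec ℕ n) (gs : Vec Carrier n) → lin (Vec.map (_% p) ks) gs ≈ lin ks gs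
  lin-% []       []       = refl
  lin-% (k ∷ ks) (g ∷ gs) = ∙-cong (pow-% g k) (lin-% ks gs)

  lin-p∸1 : (ks : Vec ℕ n) {gs : Vec Carrier n} → AllPairs Commute gs →
            lin (Vec.map ((p ∸ 1) *_) ks) gs ≈ lin ks gs ⁻¹
  lin-p∸1 ks comm = trans (lin-* (p ∸ 1) ks comm) (pow-p∸1 _)

  Independent : ∀ {n} → Vec Carrier n → Set ℓ
  Independent gs = ∀ ks → lin ks gs ≈ ε → All (p ∣_) ks

-- Coefficient vectors modulo p

residues : ℕ → (n : ℕ) → List (Vec ℕ n)
residues p zero    = [] ∷ []
residues p (suc n) = cartesianProductWith _∷_ (upTo p) (residues p n)

length-cartesianProductWith : ∀ {A B C : Set} (f : A → B → C) xs ys →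
  length (cartesianProductWith f xs ys) ≡ length xs * length ys
length-cartesianProductWith f []       ys = ≡.refl
length-cartesianProductWith f (x ∷ xs) ys = ≡.trans (length-++ (List.map (f x) ys))
  (cong₂ _+_ (length-map (f x) ys) (length-cartesianProductWith f xs ys))

length-residues : ∀ p n → length (residues p n) ≡ p ^ℕ n
length-residues p zero    = ≡.refl
length-residues p (suc n) = ≡.trans (length-cartesianProductWith _∷_ (upTo p) (residues p n))
  (cong₂ _*_ (length-upTo p) (length-residues p n))

map-%-∈ : ∀ p .{{_ : NonZero p}} (ks : Vec ℕ n) → Vec.map (_% p) ks ∈ residues p n
map-%-∈ p []       = here ≡.refl
map-%-∈ p (k ∷ ks) = ∈-cartesianProductWith⁺ _∷_ (∈-upTo⁺ (m%n<n k p)) (map-%-∈ p ks)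

-- Counting by sums of indicators

⟦_⟧ : {X : Set a} → Dec X → ℕ
⟦ d ⟧ = if does d then 1 else 0

⟦⟧-yes : {X : Set a} (d : Dec X) → X → ⟦ d ⟧ ≡ 1
⟦⟧-yes (yes _) x = ≡.refl
⟦⟧-yes (no ¬x) x = contradiction x ¬x

⟦⟧-no : {X : Set a} (d : Dec X) → ¬ X → ⟦ d ⟧ ≡ 0
⟦⟧-no (yes x) ¬x = contradiction x ¬x
⟦⟧-no (no _)  ¬x = ≡.refl

⟦⟧-mono : {X : Set a} {Y : Set b} (d : Dec X) (e : Dec Y) → (X → Y) → ⟦ d ⟧ ≤ ⟦ e ⟧
⟦⟧-mono (yes x) e f = ℕ.≤-reflexive (≡.sym (⟦⟧-yes e (f x)))
⟦⟧-mono (no _)  e f = z≤n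

sum-mono : {f g : Fin n → ℕ} → (∀ i → f i ≤ g i) → sum f ≤ sum g
sum-mono {zero}  f≤g = z≤n
sum-mono {suc n} f≤g = ℕ.+-mono-≤ (f≤g zero) (sum-mono (f≤g ∘ suc))

sum-const : ∀ n k → sum {n} (λ _ → k) ≡ n * k
sum-const zero    k = ≡.refl
sum-const (suc n) k = cong (k +_) (sum-const n k)

sum-zero : {f : Fin n → ℕ} → (∀ i → f i ≡ 0) → sum f ≡ 0
sum-zero {n} f≡0 = ≡.trans (sum-cong-≗ f≡0) (≡.trans (sum-const n 0) (ℕ.*-zeroʳ n))

term≤sum : (f : Fin n → ℕ) (i : Fin n) → f i ≤ sum f
term≤sum f zero    = ℕ.m≤m+n _ _
term≤sum f (suc i) = ℕ.≤-trans (term≤sum (f ∘ suc) i) (ℕ.m≤n+m _ _)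

sum-unique≤ : {P : Pred (Fin n) ℓ₁} (P? : Decidable P) {X : Set ℓ₂} (X? : Dec X) →
              (∀ {i} → P i → X) → (∀ {i j} → P i → P j → i ≡ j) → sum (λ i → ⟦ P? i ⟧) ≤ ⟦ X? ⟧
sum-unique≤ {zero}  P? X? P⇒X unique = z≤n
sum-unique≤ {suc n} P? X? P⇒X unique with P? zero
... | yes p₀ = ℕ.≤-reflexive (≡.trans
  (cong suc (sum-zero (λ i → ⟦⟧-no (P? (suc i)) λ pᵢ → case unique p₀ pᵢ of λ ())))
  (≡.sym (⟦⟧-yes X? (P⇒X p₀))))
... | no _  = sum-unique≤ (P? ∘ suc) X? P⇒X (λ p q → Fin.suc-injective (unique p q))

-- Double counting of the graph of `f` over `P`: each row from `P` has an entry, and each column has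
-- at most one, and none outside `Q`.
sum-injection : {P : Pred (Fin m) ℓ₁} {Q : Pred (Fin n) ℓ₂} (P? : Decidable P) (Q? : Decidable Q)
                (f : Fin m → Fin n) → (∀ {i} → P i → Q (f i)) →
                (∀ {i j} → P i → P j → f i ≡ f j → i ≡ j) →
                sum (λ i → ⟦ P? i ⟧) ≤ sum (λ j → ⟦ Q? j ⟧)
sum-injection {P = P} {Q} P? Q? f P⇒Q f-inj = begin
  sum (λ i → ⟦ P? i ⟧)                  ≤⟨ sum-mono (λ i → row i) ⟩
  sum (λ i → sum (λ j → ⟦ R? i j ⟧))    ≡⟨ ∑-comm (λ i j → ⟦ R? i j ⟧) ⟩
  sum (λ j → sum (λ i → ⟦ R? i j ⟧))    ≤⟨ sum-mono (λ j → sum-unique≤ (λ i → R? i j) (Q? j)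
    (λ (p , fi≡j) → subst Q fi≡j (P⇒Q p))
    (λ (p , fi≡j) (p′ , fi′≡j) → f-inj p p′ (≡.trans fi≡j (≡.sym fi′≡j)))) ⟩
  sum (λ j → ⟦ Q? j ⟧)                  ∎
  where
  open ℕ.≤-Reasoning
  R? : ∀ i j → Dec (P i × f i ≡ j)
  R? i j = P? i ×-dec f i Fin.≟ j
  row : ∀ i → ⟦ P? i ⟧ ≤ sum (λ j → ⟦ R? i j ⟧)
  row i = ℕ.≤-trans (⟦⟧-mono (P? i) (R? i (f i)) (_, ≡.refl)) (term≤sum (λ j → ⟦ R? i j ⟧) (f i))

module Counting (S : Setoid c ℓ) {N : ℕ} (enumeration : Inverse S (≡.setoid (Fin N))) where
  open Setoid S
  open Inverse enumeration using (to; from; to-cong; strictlyInverseˡ; strictlyInverseʳ)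

  # : {P : Pred Carrier ℓ₁} → Decidable P → ℕ
  # P? = sum (λ i → ⟦ P? (from i) ⟧)

  to-injective : ∀ {x y} → to x ≡ to y → x ≈ y
  to-injective {x} {y} eq = trans (sym (strictlyInverseʳ x))
    (trans (reflexive (cong from eq)) (strictlyInverseʳ y))

  from-injective : ∀ {i j} → from i ≈ from j → i ≡ j
  from-injective {i} {j} eq = ≡.trans (≡.sym (strictlyInverseˡ i))
    (≡.trans (to-cong eq) (strictlyInverseˡ j))

  infix 4 _≈?_
  _≈?_ : ∀ x y → Dec (x ≈ y)
  x ≈? y with to x Fin.≟ to y
  ... | yes eq = yes (to-injective eq)
  ... | no neq = no (neq ∘ to-cong)

  ∃? : {P : Pred Carrier ℓ₁} (P? : Decidable P) → P Respects _≈_ → Dec (∃ P)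
  ∃? P? P-resp with any? (P? ∘ from)
  ... | yes (i , p) = yes (from i , p)
  ... | no ¬p       = no λ (x , p) → ¬p (to x , P-resp (sym (strictlyInverseʳ x)) p)

  #<N⇒∃¬ : {P : Pred Carrier ℓ₁} (P? : Decidable P) → # P? < N → ∃ (¬_ ∘ P)
  #<N⇒∃¬ P? #<N with any? (¬? ∘ P? ∘ from)
  ... | yes (i , ¬p) = from i , ¬p
  ... | no ∄¬p = contradiction #<N (ℕ.≤⇒≯ (begin
    N                               ≡⟨ ℕ.*-identityʳ N ⟨
    N * 1                           ≡⟨ sum-const N 1 ⟨
    sum {N} (λ _ → 1)               ≡⟨ sum-cong-≗ (λ i → ⟦⟧-yes (P? (from i))
      (decidable-stable (P? (from i)) (λ ¬p → ∄¬p (i , ¬p)))) ⟨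
    # P?                            ∎))
    where
    open ℕ.≤-Reasoning

  #≡0 : {P : Pred Carrier ℓ₁} (P? : Decidable P) → (∀ x → ¬ P x) → # P? ≡ 0
  #≡0 P? ∄ = sum-zero (λ i → ⟦⟧-no (P? (from i)) (∄ (from i)))

  #-full : {P : Pred Carrier ℓ₁} (P? : Decidable P) → (∀ x → P x) → # P? ≡ N
  #-full P? all = ≡.trans (sum-cong-≗ (λ i → ⟦⟧-yes (P? (from i)) (all (from i))))
    (≡.trans (sum-const N 1) (ℕ.*-identityʳ N))

  module _ {P : Pred Carrier ℓ₁} {Q : Pred Carrier ℓ₂} (P? : Decidable P) (Q? : Decidable Q) where

    #-mono : (∀ {x} → P x → Q x) → # P? ≤ # Q?
    #-mono P⇒Q = sum-mono (λ i → ⟦⟧-mono (P? (from i)) (Q? (from i)) P⇒Q)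

    #-injection : Q Respects _≈_ → (f : Carrier → Carrier) → (∀ {x} → P x → Q (f x)) →
                  (∀ {x y} → f x ≈ f y → x ≈ y) → # P? ≤ # Q?
    #-injection Q-resp f P⇒Q f-inj = sum-injection (P? ∘ from) (Q? ∘ from) (to ∘ f ∘ from)
      (λ p → Q-resp (sym (strictlyInverseʳ _)) (P⇒Q p))
      (λ _ _ eq → from-injective (f-inj (to-injective eq)))

    #-union : ∀ {R : Pred Carrier ℓ₃} (R? : Decidable R) → (∀ {x} → R x → P x ⊎ Q x) →
              # R? ≤ # P? + # Q?
    #-union R? R⇒ = ℕ.≤-trans
      (sum-mono (λ i → pointwise (R? (from i)) (P? (from i)) (Q? (from i)) R⇒))
      (ℕ.≤-reflexive (∑-distrib-+ (λ i → ⟦ P? (from i) ⟧) (λ i → ⟦ Q? (from i) ⟧)))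
      where
      pointwise : {X : Set ℓ₃} {Y : Set ℓ₁} {Z : Set ℓ₂} (d : Dec X) (e : Dec Y) (f : Dec Z) →
                  (X → Y ⊎ Z) → ⟦ d ⟧ ≤ ⟦ e ⟧ + ⟦ f ⟧
      pointwise (no _)  e f g = z≤n
      pointwise (yes x) e f g with g x
      ... | inj₁ y = ℕ.≤-trans (ℕ.≤-reflexive (≡.sym (⟦⟧-yes e y))) (ℕ.m≤m+n _ _)
      ... | inj₂ z = ℕ.≤-trans (ℕ.≤-reflexive (≡.sym (⟦⟧-yes f z))) (ℕ.m≤n+m _ _)

  #-⋃ : {X : Set a} {P : X → Pred Carrier ℓ₁} (P? : ∀ x → Decidable (P x)) (xs : List X) {q : ℕ} →
        (∀ {x} → x ∈ xs → # (P? x) ≤ q) → # (λ g → Any.any? (λ x → P? x g) xs) ≤ length xs * q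
  #-⋃ P? []       bound = ℕ.≤-reflexive (#≡0 (λ g → Any.any? (λ x → P? x g) []) λ _ ())
  #-⋃ P? (x ∷ xs) bound = ℕ.≤-trans
    (#-union (P? x) (λ g → Any.any? (λ x → P? x g) xs) (λ g → Any.any? (λ x → P? x g) (x ∷ xs)) Any.toSum)
    (ℕ.+-mono-≤ (bound (here ≡.refl)) (#-⋃ P? xs (bound ∘ there)))

module GroupCounting (A : Group c ℓ) {N : ℕ} (enumeration : Inverse (Group.setoid A) (≡.setoid (Fin N))) where
  open Group A renaming (setoid to setoid-A)
  open GroupProperties A
  open Counting setoid-A enumeration public
  open Inverse enumeration using (from)

  -- Counts the pairs (x, g) with x in P and x⁻¹g in Q. Each x in P occurs in exactly #Q of them.
  -- For a fixed g with one solution x, any other solution y has x⁻¹y in R, so g occurs in at most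
  -- #R of them. With subgroups P, Q and R = P ∩ Q this bounds the index of an intersection; with an
  -- arbitrary set P and a subgroup Q it is the pigeonhole argument on cosets of Q.
  #*#≤N*# : {P : Pred Carrier ℓ₁} {Q : Pred Carrier ℓ₂} {R : Pred Carrier ℓ₃}
            (P? : Decidable P) (Q? : Decidable Q) (R? : Decidable R) →
            P Respects _≈_ → Q Respects _≈_ → R Respects _≈_ →
            (∀ {x x′ y y′} → P x → P x′ → Q y → Q y′ → x ∙ y ≈ x′ ∙ y′ → R (x ⁻¹ ∙ x′)) →
            # P? * # Q? ≤ N * # R?
  #*#≤N*# {P = P} {Q} {R} P? Q? R? P-resp Q-resp R-resp quotient = begin
    # P? * # Q?                                      ≡⟨ *-distribʳ-sum (# Q?) (λ i → ⟦ P? (from i) ⟧) ⟩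
    sum (λ i → ⟦ P? (from i) ⟧ * # Q?)               ≤⟨ sum-mono (λ i → row (from i)) ⟩
    sum (λ i → # (T? (from i)))                      ≡⟨ ∑-comm (λ i j → ⟦ T? (from i) (from j) ⟧) ⟩
    sum (λ j → # (λ x → T? x (from j)))              ≤⟨ sum-mono (λ j → column (from j)) ⟩
    sum {N} (λ _ → # R?)                             ≡⟨ sum-const N (# R?) ⟩
    N * # R?                                         ∎
    where
    open ℕ.≤-Reasoning
    T : Carrier → Carrier → Set _
    T x g = P x × Q (x ⁻¹ ∙ g)
    T? : ∀ x g → Dec (T x g)
    T? x g = P? x ×-dec Q? (x ⁻¹ ∙ g)
    row : ∀ x → ⟦ P? x ⟧ * # Q? ≤ # (T? x)
    row x with P? x
    ... | no _   = z≤n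
    ... | yes px = ℕ.≤-trans (ℕ.≤-reflexive (ℕ.*-identityˡ _))
      (#-injection Q? (λ g → yes px ×-dec Q? (x ⁻¹ ∙ g))
        (λ g≈h (px , q) → px , Q-resp (∙-congˡ g≈h) q) (x ∙_)
        (λ q → px , Q-resp (sym (\\-leftDividesʳ x _)) q) (∙-cancelˡ x _ _))
    column : ∀ g → # (λ x → T? x g) ≤ # R?
    column g with ∃? (λ x → T? x g) (λ x≈y (px , q) → P-resp x≈y px , Q-resp (∙-congʳ (⁻¹-cong x≈y)) q)
    ... | no ∄              = ℕ.≤-trans (ℕ.≤-reflexive (#≡0 (λ x → T? x g) (λ x t → ∄ (x , t)))) z≤n
    ... | yes (x , px , q)  = #-injection (λ y → T? y g) R? R-resp (x ⁻¹ ∙_)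
      (λ {y} (py , q′) → quotient px py q q′ (trans (\\-leftDividesˡ x g) (sym (\\-leftDividesˡ y g))))
      (∙-cancelˡ (x ⁻¹) _ _)

-- Commutators in groups of class two

-- The recursion follows that of `commutators`, so the lengths of the vectors agree definitionally.
binomial₂ : ℕ → ℕ
binomial₂ zero    = 0
binomial₂ (suc n) = n + binomial₂ n

binomial₂-mono : m ≤ n → binomial₂ m ≤ binomial₂ n
binomial₂-mono z≤n       = z≤n
binomial₂-mono (s≤s m≤n) = ℕ.+-mono-≤ m≤n (binomial₂-mono m≤n)

n≤1+binomial₂ : ∀ n → n ≤ suc (binomial₂ n)
n≤1+binomial₂ zero    = z≤n
n≤1+binomial₂ (suc n) = s≤s (ℕ.m≤m+n n _)

2*binomial₂+n : ∀ n → (binomial₂ n + binomial₂ n) + n ≡ n * n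
2*binomial₂+n zero    = ≡.refl
2*binomial₂+n (suc n) = ≡.trans (expand n (binomial₂ n))
  (≡.trans (cong (λ x → x + n + suc n) (2*binomial₂+n n)) (square n))
  where
  expand : ∀ n b → ((n + b) + (n + b)) + suc n ≡ ((b + b) + n) + n + suc n
  expand = solve-∀
  square : ∀ n → n * n + n + suc n ≡ suc n * suc n
  square = solve-∀

module Commutators (G : Group c ℓ) where
  open Group G
  open GroupProperties G
  open GroupTheory G hiding (_^_; derived; classTwoExponentSubgroup) public
  open Powers G
  open SetoidReasoning (Group.setoid G)

  exchange : ∀ x y → x ∙ y ≈ (y ∙ x) ∙ [ x , y ]
  exchange x y = sym (begin
    (y ∙ x) ∙ (x ⁻¹ ∙ y ⁻¹ ∙ x ∙ y)        ≈⟨ ∙-congˡ (assoc _ x y) ⟩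
    (y ∙ x) ∙ (x ⁻¹ ∙ y ⁻¹ ∙ (x ∙ y))      ≈⟨ ∙-congˡ (∙-congʳ (⁻¹-anti-homo-∙ y x)) ⟨
    (y ∙ x) ∙ ((y ∙ x) ⁻¹ ∙ (x ∙ y))       ≈⟨ \\-leftDividesˡ (y ∙ x) (x ∙ y) ⟩
    x ∙ y                                  ∎)

  commutator-unique : ∀ {x y z} → x ∙ y ≈ (y ∙ x) ∙ z → [ x , y ] ≈ z
  commutator-unique {x} {y} eq = ∙-cancelˡ (y ∙ x) _ _ (trans (sym (exchange x y)) eq)

  commute⇒[,]≈ε : ∀ {x y} → Commute x y → [ x , y ] ≈ ε
  commute⇒[,]≈ε xy≈yx = commutator-unique (trans xy≈yx (sym (identityʳ _)))

  [,]≈ε⇒commute : ∀ {x y} → [ x , y ] ≈ ε → Commute x y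
  [,]≈ε⇒commute {x} {y} eq = trans (exchange x y) (trans (∙-congˡ eq) (identityʳ _))

  -- The commutators with the head come first, so that splitting a coefficient vector separates the
  -- relations that involve the newest element from the older ones.
  commutators : Vec Carrier n → Vec Carrier (binomial₂ n)
  commutators []       = []
  commutators (g ∷ gs) = Vec.map [_, g ] gs Vec.++ commutators gs

module ClassTwo (G : Group c ℓ) (central : ∀ x y → GroupTheory.Centre G (GroupTheory.[_,_] G x y)) where
  open Group G
  open GroupProperties G
  open Commutators G public
  open Powers G
  open SetoidReasoning (Group.setoid G)

  [,]-∙ˡ : ∀ x y z → [ x ∙ y , z ] ≈ [ x , z ] ∙ [ y , z ]
  [,]-∙ˡ x y z = commutator-unique (begin
    (x ∙ y) ∙ z                               ≈⟨ assoc x y z ⟩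
    x ∙ (y ∙ z)                               ≈⟨ ∙-congˡ (exchange y z) ⟩
    x ∙ ((z ∙ y) ∙ [ y , z ])                 ≈⟨ ∙-congˡ (assoc z y _) ⟩
    x ∙ (z ∙ (y ∙ [ y , z ]))                 ≈⟨ assoc x z _ ⟨
    (x ∙ z) ∙ (y ∙ [ y , z ])                 ≈⟨ ∙-congʳ (exchange x z) ⟩
    ((z ∙ x) ∙ [ x , z ]) ∙ (y ∙ [ y , z ])   ≈⟨ swap-middle (z ∙ x) _ (central x z y) ⟩
    ((z ∙ x) ∙ y) ∙ ([ x , z ] ∙ [ y , z ])   ≈⟨ ∙-congʳ (assoc z x y) ⟩
    (z ∙ (x ∙ y)) ∙ ([ x , z ] ∙ [ y , z ])   ∎)

  [,]-∙ʳ : ∀ x y z → [ x , y ∙ z ] ≈ [ x , y ] ∙ [ x , z ]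
  [,]-∙ʳ x y z = commutator-unique (begin
    x ∙ (y ∙ z)                               ≈⟨ assoc x y z ⟨
    (x ∙ y) ∙ z                               ≈⟨ ∙-congʳ (exchange x y) ⟩
    ((y ∙ x) ∙ [ x , y ]) ∙ z                 ≈⟨ assoc _ _ z ⟩
    (y ∙ x) ∙ ([ x , y ] ∙ z)                 ≈⟨ ∙-congˡ (central x y z) ⟩
    (y ∙ x) ∙ (z ∙ [ x , y ])                 ≈⟨ assoc y x _ ⟩
    y ∙ (x ∙ (z ∙ [ x , y ]))                 ≈⟨ ∙-congˡ (assoc x z _) ⟨
    y ∙ ((x ∙ z) ∙ [ x , y ])                 ≈⟨ ∙-congˡ (∙-congʳ (exchange x z)) ⟩
    y ∙ (((z ∙ x) ∙ [ x , z ]) ∙ [ x , y ])   ≈⟨ ∙-congˡ (assoc _ _ _) ⟩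
    y ∙ ((z ∙ x) ∙ ([ x , z ] ∙ [ x , y ]))   ≈⟨ assoc y _ _ ⟨
    (y ∙ (z ∙ x)) ∙ ([ x , z ] ∙ [ x , y ])   ≈⟨ ∙-cong (sym (assoc y z x)) (central x z _) ⟩
    ((y ∙ z) ∙ x) ∙ ([ x , y ] ∙ [ x , z ])   ∎)

  [ε,] : ∀ y → [ ε , y ] ≈ ε
  [ε,] y = commute⇒[,]≈ε (sym (commute-ε y))

  [,ε] : ∀ x → [ x , ε ] ≈ ε
  [,ε] x = commute⇒[,]≈ε (commute-ε x)

  [,]-powˡ : ∀ x k y → [ pow x k , y ] ≈ pow [ x , y ] k
  [,]-powˡ x zero    y = [ε,] y
  [,]-powˡ x (suc k) y = trans ([,]-∙ˡ x (pow x k) y) (∙-congˡ ([,]-powˡ x k y))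

  [,]-powʳ : ∀ x y k → [ x , pow y k ] ≈ pow [ x , y ] k
  [,]-powʳ x y zero    = [,ε] x
  [,]-powʳ x y (suc k) = trans ([,]-∙ʳ x y (pow y k)) (∙-congˡ ([,]-powʳ x y k))

  [,]-linˡ : (ks : Vec ℕ n) (gs : Vec Carrier n) (y : Carrier) →
             [ lin ks gs , y ] ≈ lin ks (Vec.map [_, y ] gs)
  [,]-linˡ []       []       y = [ε,] y
  [,]-linˡ (k ∷ ks) (g ∷ gs) y = trans ([,]-∙ˡ (pow g k) (lin ks gs) y)
    (∙-cong ([,]-powˡ g k y) ([,]-linˡ ks gs y))

  [,]-\\ : ∀ x {y z} → [ x , y ] ≈ [ x , z ] → [ x , y ⁻¹ ∙ z ] ≈ ε
  [,]-\\ x {y} {z} eq = ∙-cancelˡ [ x , y ] _ _ (begin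
    [ x , y ] ∙ [ x , y ⁻¹ ∙ z ]   ≈⟨ [,]-∙ʳ x y _ ⟨
    [ x , y ∙ (y ⁻¹ ∙ z) ]         ≈⟨ [,]-cong refl (\\-leftDividesˡ y z) ⟩
    [ x , z ]                      ≈⟨ eq ⟨
    [ x , y ]                      ≈⟨ identityʳ _ ⟨
    [ x , y ] ∙ ε                  ∎)

-- Enumeration of an elementary abelian p-group of rank n

funToFin-cong : ∀ {m n} {f g : Fin m → Fin n} → (∀ i → f i ≡ g i) → funToFin f ≡ funToFin g
funToFin-cong {zero}  f≗g = ≡.refl
funToFin-cong {suc m} f≗g = cong₂ Fin.combine (f≗g zero) (funToFin-cong (f≗g ∘ suc))

module Residue (p : ℕ) .{{_ : NonZero p}} where
  open import Data.Integer using (+_)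
  open Group (ℤ/ p) renaming (setoid to setoid-ℤ/p)
  open SetoidReasoning setoid-ℤ/p

  %-≈ : ∀ x → x ≈ + (x ℤ.%ℕ p)
  %-≈ x = ℤ∣.divides (x ℤ./ℕ p) (≡.trans
    (cong (ℤ._- + r) (≡.trans (ℤ.a≡a%ℕn+[a/ℕn]*n x p) (ℤ.+-comm (+ r) q*p)))
    (GroupProperties.//-rightDividesʳ ℤ-group (+ r) q*p))
    where
    r = x ℤ.%ℕ p
    q*p = (x ℤ./ℕ p) ℤ.* + p

  residue-unique : ∀ {r s} → r < p → s < p → + r ≈ + s → r ≡ s
  residue-unique {r} {s} r<p s<p r≈s = ℤ.+-injective (ℤ.i-j≡0⇒i≡j (+ r) (+ s)
    (ℤ.∣i∣≡0⇒i≡0 (small (ℤ∣.∣⇒∣ᵤ r≈s) bound)))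
    where
    bound : ℤ.∣ + r ℤ.- + s ∣ < p
    bound = subst (λ x → ℤ.∣ x ∣ < p) (≡.sym (ℤ.m-n≡m⊖n r s))
      (ℕ.≤-<-trans (ℤ.∣m⊝n∣≤m⊔n r s) (ℕ.⊔-pres-<m r<p s<p))
    small : ∀ {k} → p ∣ k → k < p → k ≡ 0
    small {zero}  _   _   = ≡.refl
    small {suc k} p∣k k<p = contradiction (∣⇒≤ p∣k) (ℕ.<⇒≱ k<p)

  ≈⇒%≡ : ∀ x y → x ≈ y → x ℤ.%ℕ p ≡ y ℤ.%ℕ p
  ≈⇒%≡ x y x≈y = residue-unique (ℤ.n%ℕd<d x p) (ℤ.n%ℕd<d y p) (begin
    + (x ℤ.%ℕ p)  ≈⟨ %-≈ x ⟨
    x             ≈⟨ x≈y ⟩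
    y             ≈⟨ %-≈ y ⟩
    + (y ℤ.%ℕ p)  ∎)

  %≡⇒≈ : ∀ x y → x ℤ.%ℕ p ≡ y ℤ.%ℕ p → x ≈ y
  %≡⇒≈ x y eq = begin
    x             ≈⟨ %-≈ x ⟩
    + (x ℤ.%ℕ p)  ≡⟨ cong +_ eq ⟩
    + (y ℤ.%ℕ p)  ≈⟨ %-≈ y ⟨
    y             ∎

finite-elementary : ∀ {G : Group c ℓ} p n .{{_ : NonZero p}} → G ≅ (ℤ/ p ^ᴳ n) →
                    Inverse (Group.setoid G) (≡.setoid (Fin (p ^ℕ n)))
finite-elementary {G = G} p n (f , iso) = record
  { to        = to
  ; from      = from
  ; to-cong   = to-cong
  ; from-cong = λ { ≡.refl → refl }
  ; inverse   = (λ {i} {x} x≈ → ≡.trans (to-cong x≈) (to-from i))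
              , (λ { {x} ≡.refl → injective (λ i → begin
                  f (from (to x)) i             ≈⟨ f-from (to x) i ⟩
                  + toℕ (finToFun (to x) i)     ≡⟨ cong +_ (finToFun-to x i) ⟩
                  + (f x i ℤ.%ℕ p)              ≈⟨ %-≈ (f x i) ⟨
                  f x i                         ∎) })
  }
  where
  open import Data.Integer using (+_)
  open Group G
  open Residue p
  open SetoidReasoning (Group.setoid (ℤ/ p))
  module ℤ/p = Group (ℤ/ p)
  open GroupMorphisms.IsGroupIsomorphism iso using (injective; surjective; ⟦⟧-cong)

  residues-of : Carrier → Fin n → Fin p
  residues-of x i = fromℕ< (ℤ.n%ℕd<d (f x i) p)

  to : Carrier → Fin (p ^ℕ n)
  to x = funToFin (residues-of x)

  to-cong : ∀ {x y} → x ≈ y → to x ≡ to y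
  to-cong {x} {y} x≈y = funToFin-cong λ i → Fin.fromℕ<-cong _ _ (≈⇒%≡ (f x i) (f y i) (⟦⟧-cong x≈y i)) _ _

  from : Fin (p ^ℕ n) → Carrier
  from j = proj₁ (surjective (λ i → + toℕ (finToFun j i)))

  f-from : ∀ j i → f (from j) i ℤ/p.≈ + toℕ (finToFun j i)
  f-from j = proj₂ (surjective (λ i → + toℕ (finToFun j i))) refl

  finToFun-to : ∀ x i → toℕ (finToFun (to x) i) ≡ f x i ℤ.%ℕ p
  finToFun-to x i = ≡.trans (cong toℕ (finToFun-funToFin (residues-of x) i)) (toℕ-fromℕ< _)

  to-from : ∀ j → to (from j) ≡ j
  to-from j = ≡.trans (funToFin-cong λ i → toℕ-injective (≡.trans (toℕ-fromℕ< _)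
      (≡.trans (≈⇒%≡ (f (from j) i) _ (f-from j i)) (ℕ.m<n⇒m%n≡m (toℕ<n (finToFun j i))))))
    (funToFin-finToFin {n} {p} j)

-- Isotropic and complete families modulo the derived subgroup

allPairs-universal : ∀ {a r} {X : Set a} {R : Rel X r} → (∀ x y → R x y) →
                     (xs : Vec X n) → AllPairs R xs
allPairs-universal r []       = []
allPairs-universal r (x ∷ xs) = All.universal (r x) xs ∷ allPairs-universal r xs

-- _∼_ is equality modulo the derived subgroup; it is abstract because the
-- equality of a quotient group unfolds to membership of x ∙ y ⁻¹, from which x
-- and y cannot be inferred.
module Extraction (G : Group c ℓ)
  (central : ∀ x y → GroupTheory.Centre G (GroupTheory.[_,_] G x y))
  {p : ℕ} (p-prime : Prime p) (pow-p : ∀ g → Group._≈_ G (Powers.pow G g p) (Group.ε G))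
  (_≈?_ : ∀ x y → Dec (Group._≈_ G x y))
  {_∼_ : Rel (Group.Carrier G) ℓ₁}
  (∼-isGroup : IsGroup _∼_ (Group._∙_ G) (Group.ε G) (Group._⁻¹ G))
  (∼-comm : ∀ x y → Group._∙_ G x y ∼ Group._∙_ G y x)
  (≈⇒∼ : ∀ {x y} → Group._≈_ G x y → x ∼ y)
  ([,]-∼ˡ : ∀ {x y} z → x ∼ y → Group._≈_ G (GroupTheory.[_,_] G x z) (GroupTheory.[_,_] G y z))
  ([,]-∼ʳ : ∀ {x y} z → x ∼ y → Group._≈_ G (GroupTheory.[_,_] G z x) (GroupTheory.[_,_] G z y))
  (n : ℕ) (enumeration : Inverse (IsGroup.setoid ∼-isGroup) (≡.setoid (Fin (p ^ℕ n))))
  where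
  open Group G hiding (setoid)

  private
    A : Group _ _
    A = record { isGroup = ∼-isGroup }

    module A where
      open Group A public
      open Powers A public
      open Exponent A p-prime (λ g → ≈⇒∼ (pow-p g)) public

    instance
      p≢0 : NonZero p
      p≢0 = prime⇒nonZero p-prime

    N : ℕ
    N = p ^ℕ n

    instance
      N≢0 : NonZero N
      N≢0 = ℕ.m^n≢0 p n

  open GroupProperties G
  open ClassTwo G central
  open Powers G
  open Exponent G p-prime pow-p
  open GroupCounting A enumeration renaming (_≈?_ to _∼?_)
  open SetoidReasoning A.setoid

  ∼-commuting : ∀ {m} (gs : Vec Carrier m) → AllPairs A.Commute gs
  ∼-commuting = allPairs-universal ∼-comm

  -- Stated through the commutator instead of commutation, so that it is the kernel of the map that
  -- x induces on the quotient.
  C : Carrier → Pred Carrier ℓ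
  C x u = [ x , u ] ≈ ε

  C? : ∀ x → Decidable (C x)
  C? x u = [ x , u ] ≈? ε

  C-resp : ∀ x → C x Respects _∼_
  C-resp x u∼v eq = trans (sym ([,]-∼ʳ x u∼v)) eq

  C-\\ : ∀ x {u v} → C x u → C x v → C x (u ⁻¹ ∙ v)
  C-\\ x eq eq′ = [,]-\\ x (trans eq (sym eq′))

  C-// : ∀ x {u v} → C x u → C x v → C x (u ∙ v ⁻¹)
  C-// x {u} {v} eq eq′ = C-resp x (∼-comm (v ⁻¹) u) (C-\\ x eq′ eq)

  -- A collision of two products places the quotient x⁻¹x′ of the left factors, which is controlled
  -- by the first predicate, also under the second one, as a quotient of the right factors.
  shift : ∀ {x x′ y y′} → (x ∙ y) ∼ (x′ ∙ y′) → (y ∙ y′ ⁻¹) ∼ (x ⁻¹ ∙ x′)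
  shift {x} {x′} {y} {y′} eq = begin
    y ∙ y′ ⁻¹                       ≈⟨ A.∙-congʳ (≈⇒∼ (\\-leftDividesʳ x y)) ⟨
    (x ⁻¹ ∙ (x ∙ y)) ∙ y′ ⁻¹        ≈⟨ A.∙-congʳ (A.∙-congˡ eq) ⟩
    (x ⁻¹ ∙ (x′ ∙ y′)) ∙ y′ ⁻¹      ≈⟨ A.assoc _ _ _ ⟩
    x ⁻¹ ∙ ((x′ ∙ y′) ∙ y′ ⁻¹)      ≈⟨ A.∙-congˡ (≈⇒∼ (//-rightDividesʳ y′ x′)) ⟩
    x ⁻¹ ∙ x′                       ∎

  index-∩ : {P : Pred Carrier ℓ₂} {Q : Pred Carrier ℓ₃} (P? : Decidable P) (Q? : Decidable Q) →
            P Respects _∼_ → Q Respects _∼_ →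
            (∀ {x y} → P x → P y → P (x ⁻¹ ∙ y)) → (∀ {x y} → Q x → Q y → Q (x ∙ y ⁻¹)) →
            ∀ {k l} → N ≤ k * # P? → N ≤ l * # Q? → N ≤ (k * l) * # (λ x → P? x ×-dec Q? x)
  index-∩ P? Q? P-resp Q-resp P-\\ Q-// {k} {l} N≤P N≤Q = ℕ.*-cancelˡ-≤ N (R.begin
    N * N                             R.≤⟨ ℕ.*-mono-≤ N≤P N≤Q ⟩
    (k * # P?) * (l * # Q?)           R.≡⟨ ℕ.[m*n]*[o*p]≡[m*o]*[n*p] k (# P?) l (# Q?) ⟩
    (k * l) * (# P? * # Q?)           R.≤⟨ ℕ.*-monoʳ-≤ (k * l) (#*#≤N*# P? Q? R? P-resp Q-resp
      (λ x∼y (px , qx) → P-resp x∼y px , Q-resp x∼y qx)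
      (λ {x} {x′} {y} {y′} px px′ qy qy′ xy∼x′y′ → P-\\ px px′ , Q-resp (shift xy∼x′y′) (Q-// qy qy′))) ⟩
    (k * l) * (N * # R?)              R.≡⟨ swap (k * l) N (# R?) ⟩
    N * ((k * l) * # R?)              R.∎)
    where
    module R = ℕ.≤-Reasoning
    R? = λ x → P? x ×-dec Q? x
    swap : ∀ x y z → x * (y * z) ≡ y * (x * z)
    swap = solve-∀

  -- The elements whose centraliser has index at most k in the quotient.
  Low : ℕ → Pred Carrier _
  Low k x = N ≤ k * # (C? x)

  Low? : ∀ k → Decidable (Low k)
  Low? k x = N ≤? k * # (C? x)

  Low-resp : ∀ k → Low k Respects _∼_
  Low-resp k {x} {y} x∼y low = ℕ.≤-trans low
    (ℕ.*-monoʳ-≤ k (#-mono (C? x) (C? y) λ {u} eq → trans (sym ([,]-∼ˡ u x∼y)) eq))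

  Low-\\ : ∀ {k x y} → Low k x → Low k y → Low (k * k) (x ⁻¹ ∙ y)
  Low-\\ {k} {x} {y} x-low y-low = ℕ.≤-trans
    -- The two centralisers meet in index at most k * k, and whatever commutes with x and y commutes
    -- with x⁻¹y. This is the origin of the square in the families below.
    (index-∩ (C? x) (C? y) (C-resp x) (C-resp y) (C-\\ x) (C-// y) {k} {k} x-low y-low)
    (ℕ.*-monoʳ-≤ (k * k) (#-mono (λ u → C? x u ×-dec C? y u) (C? (x ⁻¹ ∙ y)) λ {u} (xu , yu) →
      commute⇒[,]≈ε (sym (commute-\\ (sym ([,]≈ε⇒commute xu)) (sym ([,]≈ε⇒commute yu))))))
    where
    commute-\\ : ∀ {u} → Commute u x → Commute u y → Commute u (x ⁻¹ ∙ y)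
    commute-\\ ux uy = [,]≈ε⇒commute ([,]-\\ _ (trans (commute⇒[,]≈ε ux) (sym (commute⇒[,]≈ε uy))))

  #≤1 : ∀ h → # (λ g → g ∼? h) ≤ 1
  #≤1 h = sum-unique≤ (λ i → Inverse.from enumeration i ∼? h) (yes tt) (λ _ → tt)
    λ {i} {j} p q → from-injective (A.trans p (A.sym q))

  module _ {m : ℕ} (gs : Vec Carrier m) where

    Span : Pred Carrier _
    Span g = Any.Any (λ ks → g ∼ lin ks gs) (residues p m)

    Span? : Decidable Span
    Span? g = Any.any? (λ ks → g ∼? lin ks gs) (residues p m)

    #Span : # Span? ≤ p ^ℕ m
    #Span = ℕ.≤-trans (#-⋃ (λ ks g → g ∼? lin ks gs) (residues p m) (λ {ks} _ → #≤1 (lin ks gs)))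
      (ℕ.≤-reflexive (≡.trans (ℕ.*-identityʳ _) (length-residues p m)))

    span : ∀ {g} ks → g ∼ lin ks gs → Span g
    span ks eq = lose (map-%-∈ p ks) (A.trans eq (A.sym (A.lin-% ks gs)))

    Span-resp : Span Respects _∼_
    Span-resp x∼y = Any.map (A.trans (A.sym x∼y))

  -- If p did not divide the coefficient of g, then g would be a root of the inverse of a
  -- combination of `gs`, hence in the span.
  independent-∷ : ∀ {m g} {gs : Vec Carrier m} → ¬ Span gs g → A.Independent gs → A.Independent (g ∷ gs)
  independent-∷ {m} {g} {gs} g∉span indep (k ∷ ks) eq with p ∣? k
  ... | yes p∣k = p∣k ∷ indep ks (A.trans (A.sym (A.trans (A.∙-congʳ (A.pow-∣ g p∣k)) (A.identityˡ _))) eq)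
  ... | no  p∤k with r , root-r ← A.root p∤k = contradiction
    (span gs (Vec.map (r *_) (Vec.map ((p ∸ 1) *_) ks)) (begin
      g                                                    ≈⟨ root-r g ⟨
      pow (pow g k) r
        ≈⟨ A.pow-cong r (GroupProperties.inverseˡ-unique A (pow g k) (lin ks gs) eq) ⟩
      pow (lin ks gs ⁻¹) r                                 ≈⟨ A.pow-cong r (A.lin-p∸1 ks (∼-commuting gs)) ⟨
      pow (lin (Vec.map ((p ∸ 1) *_) ks) gs) r             ≈⟨ A.lin-* r (Vec.map ((p ∸ 1) *_) ks) (∼-commuting gs) ⟨
      lin (Vec.map (r *_) (Vec.map ((p ∸ 1) *_) ks)) gs    ∎))
    g∉span

  Centralised : ∀ {m} → Vec Carrier m → Pred Carrier _
  Centralised gs u = All (λ g → C g u) gs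

  Centralised? : ∀ {m} (gs : Vec Carrier m) → Decidable (Centralised gs)
  Centralised? gs u = All.all? (λ g → C? g u) gs

  Centralised-resp : ∀ {m} (gs : Vec Carrier m) → Centralised gs Respects _∼_
  Centralised-resp gs u∼v = All.map (λ {g} → C-resp g u∼v)

  Centralised-// : ∀ {m} (gs : Vec Carrier m) {u v} →
                   Centralised gs u → Centralised gs v → Centralised gs (u ∙ v ⁻¹)
  Centralised-// []       []       []       = []
  Centralised-// (g ∷ gs) (x ∷ xs) (y ∷ ys) = C-// g x y ∷ Centralised-// gs xs ys

  -- Isotropic for the commutator form; independence is modulo the derived subgroup. The field
  -- `index` is the invariant that turns a failure to extend the family into a bound on the low
  -- elements: the common centraliser has few cosets.
  record IsotropicFamily (K m : ℕ) : Set (c ⊔ ℓ ⊔ ℓ₁) where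
    field
      elements    : Vec Carrier m
      commuting   : AllPairs Commute elements
      independent : A.Independent elements
      index       : N ≤ K ^ℕ m * # (Centralised? elements)

  empty-family : ∀ {K} → IsotropicFamily K 0
  empty-family = record
    { elements    = []
    ; commuting   = []
    ; independent = λ { [] _ → [] }
    ; index       = ℕ.≤-reflexive (≡.sym (≡.trans (ℕ.*-identityˡ _) (#-full (Centralised? []) (λ _ → []))))
    }

  -- If no low element can be added, then two elements of Low k in the same
  -- coset of the common centraliser differ by an element of the span.
  extend-family : ∀ {k m} → IsotropicFamily (k * k) m →
                  IsotropicFamily (k * k) (suc m) ⊎ # (Low? k) ≤ (k * k) ^ℕ m * p ^ℕ m
  extend-family {k} {m} F = case ∃? T? T-resp of λ
    { (yes (g , low , g∈U , g∉span)) → inj₁ record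
      { elements    = g ∷ elements
      ; commuting   = All.map (λ eq → sym ([,]≈ε⇒commute eq)) g∈U ∷ commuting
      ; independent = independent-∷ g∉span independent
      ; index       = ℕ.≤-trans
          (index-∩ (C? g) U? (C-resp g) U-resp (C-\\ g) U-// {k * k} {(k * k) ^ℕ m} low index)
          (ℕ.*-monoʳ-≤ ((k * k) ^ℕ suc m)
            (#-mono (λ x → C? g x ×-dec U? x) (Centralised? (g ∷ elements)) λ (x , y) → x ∷ y))
      }
    ; (no ∄) → inj₂ (ℕ.*-cancelˡ-≤ N (R.begin
        N * # L?                                     R.≤⟨ ℕ.*-monoˡ-≤ (# L?) index ⟩
        ((k * k) ^ℕ m * # U?) * # L?                 R.≡⟨ rearrange ((k * k) ^ℕ m) (# U?) (# L?) ⟩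
        (k * k) ^ℕ m * (# L? * # U?)                 R.≤⟨ ℕ.*-monoʳ-≤ ((k * k) ^ℕ m)
          (#*#≤N*# L? U? (Span? elements) (Low-resp k) U-resp (Span-resp elements)
            λ {x} {x′} {y} {y′} x-low x′-low y∈U y′∈U eq → decidable-stable (Span? elements _)
              λ ∉span → ∄ (x ⁻¹ ∙ x′ , Low-\\ {k} x-low x′-low ,
                U-resp (shift eq) (U-// y∈U y′∈U) , ∉span)) ⟩
        (k * k) ^ℕ m * (N * # (Span? elements))      R.≤⟨ ℕ.*-monoʳ-≤ ((k * k) ^ℕ m) (ℕ.*-monoʳ-≤ N (#Span elements)) ⟩
        (k * k) ^ℕ m * (N * p ^ℕ m)                  R.≡⟨ rearrange′ ((k * k) ^ℕ m) N (p ^ℕ m) ⟩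
        N * ((k * k) ^ℕ m * p ^ℕ m)                  R.∎)) }
    where
    module R = ℕ.≤-Reasoning
    open IsotropicFamily F
    L? = Low? k
    U? = Centralised? elements
    U-resp = Centralised-resp elements
    U-// : ∀ {x y} → Centralised elements x → Centralised elements y → Centralised elements (x ∙ y ⁻¹)
    U-// = Centralised-// elements
    -- Candidates are tested with k * k although `L?` uses k: the candidates that the count produces
    -- are quotients of two elements of `Low k`.
    T? = λ g → Low? (k * k) g ×-dec U? g ×-dec ¬? (Span? elements g)
    T-resp : (λ g → Low (k * k) g × Centralised elements g × ¬ Span elements g) Respects _∼_
    T-resp x∼y (low , u , ∉span) = Low-resp (k * k) x∼y low , U-resp x∼y u ,
      ∉span ∘ Span-resp elements (A.sym x∼y)
    rearrange : ∀ x y z → (x * y) * z ≡ x * (z * y)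
    rearrange = solve-∀
    rearrange′ : ∀ x y z → x * (y * z) ≡ y * (x * z)
    rearrange′ = solve-∀

  isotropic-or-few-low : ∀ k s → IsotropicFamily (k * k) s ⊎ ∃[ j ] j < s × # (Low? k) ≤ (k * k) ^ℕ j * p ^ℕ j
  isotropic-or-few-low k zero    = inj₁ empty-family
  isotropic-or-few-low k (suc s) with isotropic-or-few-low k s
  ... | inj₂ (j , j<s , few) = inj₂ (j , ℕ.m<n⇒m<1+n j<s , few)
  ... | inj₁ F with extend-family {k} F
  ...   | inj₁ F′  = inj₁ F′
  ...   | inj₂ few = inj₂ (s , ℕ.n<1+n s , few)

  #-fibre : ∀ x w → # (λ g → ([ x , g ] ∙ w) ≈? ε) ≤ # (C? x)
  #-fibre x w with ∃? (λ g → ([ x , g ] ∙ w) ≈? ε) (λ g∼h eq → trans (∙-congʳ (sym ([,]-∼ʳ x g∼h))) eq)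
  ... | no ∄         = ℕ.≤-trans (ℕ.≤-reflexive (#≡0 (λ g → ([ x , g ] ∙ w) ≈? ε) (λ g eq → ∄ (g , eq)))) z≤n
  -- By bilinearity the solutions form a coset of the centraliser of x; translation by the inverse
  -- of one solution carries them into it.
  ... | yes (g , eq) = #-injection (λ h → ([ x , h ] ∙ w) ≈? ε) (C? x) (C-resp x) (g ⁻¹ ∙_)
    (λ {h} eq′ → [,]-\\ x (∙-cancelʳ w _ _ (trans eq (sym eq′))))
    (GroupProperties.∙-cancelˡ A (g ⁻¹) _ _)

  -- The induction runs on `high`: a new element u enters a relation among commutators through [x,u]
  -- with x a combination of the old elements, and unless the coefficients of x vanish modulo p its
  -- centraliser must be small. Independence of the commutators is meant in G itself.
  record CompleteFamily (k m : ℕ) : Set (c ⊔ ℓ ⊔ ℓ₁) where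
    field
      elements    : Vec Carrier m
      high        : ∀ ks → ¬ All (p ∣_) ks → ¬ Low k (lin ks elements)
      independent : Independent (commutators elements)

  module _ {k m : ℕ} (F : CompleteFamily k m) where
    open CompleteFamily F

    all∣? : ∀ {n} (ks : Vec ℕ n) → Dec (All (p ∣_) ks)
    all∣? = All.all? (p ∣?_)

    DependentCommutators : Vec ℕ (binomial₂ (suc m)) → Pred Carrier _
    DependentCommutators ks g = ¬ All (p ∣_) ks × lin ks (commutators (g ∷ elements)) ≈ ε

    dependentCommutators? : ∀ ks → Decidable (DependentCommutators ks)
    dependentCommutators? ks g = ¬? (all∣? ks) ×-dec lin ks (commutators (g ∷ elements)) ≈? ε

    -- Split the coefficients into `cs`, for the commutators with g, and `ds`, for the older ones.
    -- By bilinearity the relation reads [x,g]w = 1 with x = `lin cs elements`. If `cs` vanishes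
    -- modulo p, it is a relation among the older commutators, which are independent. Otherwise x is
    -- not low, and the solutions number at most the order of its centraliser, which is below N/k =
    -- M.
    #dependentCommutators : ∀ {M} → k * M ≡ N → ∀ ks → # (dependentCommutators? ks) ≤ M
    #dependentCommutators {M} kM≡N ks with Vec.splitAt m ks
    ... | cs , ds , ≡.refl with all∣? cs
    ...   | yes p∣cs = ℕ.≤-trans (ℕ.≤-reflexive (#≡0 (dependentCommutators? ks) λ g (p∤ks , eq) →
      p∤ks (All.++⁺ p∣cs (independent ds
        (trans (sym (trans (∙-congʳ (lin-∣ _ p∣cs)) (identityˡ _)))
          (trans (sym (lin-++ cs ds _ _)) eq)))))) z≤n
    ...   | no p∤cs = ℕ.≤-trans
      (#-mono (dependentCommutators? ks)
        (λ g → ([ lin cs elements , g ] ∙ lin ds (commutators elements)) ≈? ε)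
        λ {g} (_ , eq) → trans (∙-congʳ ([,]-linˡ cs elements g)) (trans (sym (lin-++ cs ds _ _)) eq))
      (ℕ.≤-trans (#-fibre (lin cs elements) (lin ds (commutators elements)))
        (ℕ.<⇒≤ (ℕ.*-cancelˡ-< k _ _
          (subst (k * # (C? (lin cs elements)) <_) (≡.sym kM≡N) (ℕ.≰⇒> (high cs p∤cs))))))

    LowCombination : Vec ℕ (suc m) → Pred Carrier _
    LowCombination ks g = ¬ All (p ∣_) ks × Low k (lin ks (g ∷ elements))

    lowCombination? : ∀ ks → Decidable (LowCombination ks)
    lowCombination? ks g = ¬? (all∣? ks) ×-dec Low? k (lin ks (g ∷ elements))

    -- If p divides the coefficient of g, the combination involves old elements only and `high`
    -- excludes it. Otherwise taking the l-th power is injective modulo the derived subgroup, and g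
    -- ↦ gˡx embeds the excluded elements into the low ones.
    #lowCombination : ∀ ks → # (lowCombination? ks) ≤ # (Low? k)
    #lowCombination (l ∷ ls) = case p ∣? l of λ
      { (yes p∣l) → ℕ.≤-trans (ℕ.≤-reflexive (#≡0 (lowCombination? (l ∷ ls)) λ g (p∤ks , low) →
      high ls (λ p∣ls → p∤ks (p∣l ∷ p∣ls))
        (Low-resp k (≈⇒∼ (trans (∙-congʳ (pow-∣ g p∣l)) (identityˡ _))) low))) z≤n
      ; (no p∤l) → #-injection (lowCombination? (l ∷ ls)) (Low? k) (Low-resp k)
      (λ g → pow g l ∙ lin ls elements) proj₂
      (λ eq → A.pow-injective p∤l (GroupProperties.∙-cancelʳ A (lin ls elements) _ _ eq)) }

    extend-complete : ∀ {M} → k * M ≡ N →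
                      p ^ℕ binomial₂ (suc m) * M + p ^ℕ suc m * # (Low? k) < N → CompleteFamily k (suc m)
    extend-complete {M} kM≡N few = record
      { elements    = g ∷ elements
      -- The excluded sets are indexed by residue vectors only, so an arbitrary coefficient vector
      -- is first reduced modulo p.
      ; high        = λ ks p∤ks low → g-good (inj₂ (lose (map-%-∈ p ks)
          ((λ p∣ → p∤ks (all∣-% ks p∣)) , Low-resp k (A.sym (A.lin-% ks (g ∷ elements))) low)))
      ; independent = λ ks eq → decidable-stable (all∣? ks) λ p∤ks → g-good (inj₁ (lose (map-%-∈ p ks)
          ((λ p∣ → p∤ks (all∣-% ks p∣)) , trans (lin-% ks (commutators (g ∷ elements))) eq)))
      }
      where
      all∣-% : ∀ {n} (ks : Vec ℕ n) → All (p ∣_) (Vec.map (_% p) ks) → All (p ∣_) ks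
      all∣-% []       []       = []
      all∣-% (k ∷ ks) (d ∷ ds) = ∣n∣m%n⇒∣m ∣-refl d ∷ all∣-% ks ds

      bad₁? : Decidable (λ g → Any.Any (λ ks → DependentCommutators ks g) (residues p (binomial₂ (suc m))))
      bad₁? g = Any.any? (λ ks → dependentCommutators? ks g) (residues p (binomial₂ (suc m)))

      bad₂? : Decidable (λ g → Any.Any (λ ks → LowCombination ks g) (residues p (suc m)))
      bad₂? g = Any.any? (λ ks → lowCombination? ks g) (residues p (suc m))

      bad? = λ g → bad₁? g ⊎-dec bad₂? g

      #bad : # bad? ≤ p ^ℕ binomial₂ (suc m) * M + p ^ℕ suc m * # (Low? k)
      #bad = ℕ.≤-trans (#-union bad₁? bad₂? bad? (λ x → x)) (ℕ.+-mono-≤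
        (subst (λ r → # bad₁? ≤ r * M) (length-residues p (binomial₂ (suc m)))
          (#-⋃ dependentCommutators? (residues p (binomial₂ (suc m))) λ {ks} _ → #dependentCommutators kM≡N ks))
        (subst (λ r → # bad₂? ≤ r * # (Low? k)) (length-residues p (suc m))
          (#-⋃ lowCombination? (residues p (suc m)) λ {ks} _ → #lowCombination ks)))

      good = #<N⇒∃¬ bad? (ℕ.≤-<-trans #bad few)

      g = proj₁ good
      g-good = proj₂ good

  complete-family : ∀ {k M} t → k * M ≡ N →
                    (∀ m → m < t → p ^ℕ binomial₂ (suc m) * M + p ^ℕ suc m * # (Low? k) < N) →
                    CompleteFamily k t
  complete-family zero    kM≡N few = record
    { elements = [] ; high = λ { [] p∤ _ → p∤ [] } ; independent = λ { [] _ → [] } }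
  complete-family (suc t) kM≡N few = extend-complete
    (complete-family t kM≡N (λ m m<t → few m (ℕ.m<n⇒m<1+n m<t))) kM≡N (few t (ℕ.n<1+n t))

  isotropic-or-complete : 2 < p → ∀ s t → let d = suc (binomial₂ t) in suc (d + d) * s ≤ n →
                          IsotropicFamily (p ^ℕ d * p ^ℕ d) s ⊎ CompleteFamily (p ^ℕ d) t
  isotropic-or-complete 2<p s t s-bound with isotropic-or-few-low (p ^ℕ suc (binomial₂ t)) s
  ... | inj₁ F = inj₁ F
  ... | inj₂ (j , j<s , few) = inj₂ (complete-family t kM≡N λ m m<t → R.begin-strict
    p ^ℕ binomial₂ (suc m) * M + p ^ℕ suc m * # (Low? k)   R.≤⟨ ℕ.+-mono-≤ (first m m<t) (second m m<t) ⟩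
    -- Three copies of p^(n-1) fit into p^n because p ≥ 3; the third copy makes the inequality
    -- strict.
    p ^ℕ ℕ.pred n + p ^ℕ ℕ.pred n                          R.<⟨ ℕ.m<m+n _ (ℕ.>-nonZero⁻¹ _) ⟩
    (p ^ℕ ℕ.pred n + p ^ℕ ℕ.pred n) + p ^ℕ ℕ.pred n        R.≡⟨ three (p ^ℕ ℕ.pred n) ⟩
    3 * p ^ℕ ℕ.pred n                                      R.≤⟨ ℕ.*-monoˡ-≤ (p ^ℕ ℕ.pred n) 2<p ⟩
    p ^ℕ suc (ℕ.pred n)                                    R.≡⟨ cong (p ^ℕ_) (ℕ.suc-pred n) ⟩
    N                                                      R.∎)
    where
    module R = ℕ.≤-Reasoning
    d = suc (binomial₂ t)
    k = p ^ℕ d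
    M = p ^ℕ (n ∸ d)

    1+2d[1+j]≤n : suc (d + d) * suc j ≤ n
    1+2d[1+j]≤n = ℕ.≤-trans (ℕ.*-monoʳ-≤ (suc (d + d)) j<s) s-bound

    d≤n : d ≤ n
    d≤n = ℕ.≤-trans (ℕ.≤-trans (ℕ.m≤m+n d (suc d)) (ℕ.≤-reflexive (ℕ.+-suc d d)))
      (ℕ.≤-trans (ℕ.m≤m*n (suc (d + d)) (suc j)) 1+2d[1+j]≤n)

    instance
      n≢0 : NonZero n
      n≢0 = ℕ.>-nonZero (ℕ.<-≤-trans (s≤s z≤n) d≤n)
      pⁿ⁻¹≢0 : NonZero (p ^ℕ ℕ.pred n)
      pⁿ⁻¹≢0 = ℕ.m^n≢0 p (ℕ.pred n)

    kM≡N : k * M ≡ N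
    kM≡N = ≡.trans (≡.sym (ℕ.^-distribˡ-+-* p d (n ∸ d))) (cong (p ^ℕ_) (ℕ.m+[n∸m]≡n d≤n))

    three : ∀ x → (x + x) + x ≡ 3 * x
    three = solve-∀

    first : ∀ m → m < t → p ^ℕ binomial₂ (suc m) * M ≤ p ^ℕ ℕ.pred n
    first m m<t = R.begin
      p ^ℕ binomial₂ (suc m) * M                    R.≡⟨ ℕ.^-distribˡ-+-* p (binomial₂ (suc m)) (n ∸ d) ⟨
      -- Since `d` is a successor, the predecessor on the next line reduces to
      -- `binomial₂ t + (n ∸ d)`: the extra 1 in `d` is what saves a factor p.
      p ^ℕ (binomial₂ (suc m) + (n ∸ d))            R.≤⟨ ℕ.^-monoʳ-≤ p (ℕ.+-monoˡ-≤ (n ∸ d) (binomial₂-mono m<t)) ⟩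
      p ^ℕ (ℕ.pred (d + (n ∸ d)))                   R.≡⟨ cong (λ e → p ^ℕ ℕ.pred e) (ℕ.m+[n∸m]≡n d≤n) ⟩
      p ^ℕ ℕ.pred n                                 R.∎

    second : ∀ m → m < t → p ^ℕ suc m * # (Low? k) ≤ p ^ℕ ℕ.pred n
    second m m<t = R.begin
      p ^ℕ suc m * # (Low? k)                       R.≤⟨ ℕ.*-monoʳ-≤ (p ^ℕ suc m) few ⟩
      p ^ℕ suc m * ((k * k) ^ℕ j * p ^ℕ j)          R.≡⟨ cong (λ x → p ^ℕ suc m * (x ^ℕ j * p ^ℕ j)) (ℕ.^-distribˡ-+-* p d d) ⟨
      p ^ℕ suc m * ((p ^ℕ (d + d)) ^ℕ j * p ^ℕ j)   R.≡⟨ cong (λ x → p ^ℕ suc m * (x * p ^ℕ j)) (ℕ.^-*-assoc p (d + d) j) ⟩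
      p ^ℕ suc m * (p ^ℕ ((d + d) * j) * p ^ℕ j)    R.≡⟨ cong (p ^ℕ suc m *_) (ℕ.^-distribˡ-+-* p ((d + d) * j) j) ⟨
      p ^ℕ suc m * p ^ℕ ((d + d) * j + j)           R.≡⟨ ℕ.^-distribˡ-+-* p (suc m) _ ⟨
      p ^ℕ (suc m + ((d + d) * j + j))              R.≤⟨ ℕ.^-monoʳ-≤ p (exponent-bound m m<t) ⟩
      p ^ℕ ℕ.pred n                                 R.∎
      where
      exponent-bound : ∀ m → m < t → suc m + ((d + d) * j + j) ≤ ℕ.pred n
      exponent-bound m m<t = ℕ.s≤s⁻¹ (R.begin
        -- From m + 1 ≤ t ≤ d ≤ 2d the left side is at most (2d + 1)(j + 1), and j + 1 ≤ s.
        suc (suc m + ((d + d) * j + j))             R.≤⟨ s≤s (ℕ.+-monoˡ-≤ _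
          (ℕ.≤-trans (ℕ.≤-trans m<t (n≤1+binomial₂ t)) (ℕ.m≤m+n d d))) ⟩
        suc ((d + d) + ((d + d) * j + j))           R.≡⟨ collect (d + d) j ⟩
        suc (d + d) * suc j                         R.≤⟨ 1+2d[1+j]≤n ⟩
        n                                           R.≡⟨ ℕ.suc-pred n ⟨
        suc (ℕ.pred n)                              R.∎)
        where
        collect : ∀ x j → suc (x + (x * j + j)) ≡ suc x * suc j
        collect = solve-∀

-- Normal forms: products of generators times products of commutators

module NormalForm (G : Group c ℓ) (central : ∀ x y → GroupTheory.Centre G (GroupTheory.[_,_] G x y))
                  {p : ℕ} (p-prime : Prime p) (pow-p : ∀ g → Group._≈_ G (Powers.pow G g p) (Group.ε G)) where
  open Group G
  open GroupProperties G
  open ClassTwo G central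
  open Powers G
  open Exponent G p-prime pow-p
  open SetoidReasoning (Group.setoid G)

  lin-central : (ks : Vec ℕ n) {zs : Vec Carrier n} → All Centre zs → Centre (lin ks zs)
  lin-central ks zs-central x = sym (commute-lin ks (All.map (λ z-central → sym (z-central x)) zs-central))

  central⇒commuting : {zs : Vec Carrier n} → All Centre zs → AllPairs Commute zs
  central⇒commuting []        = []
  central⇒commuting (z ∷ zs)  = All.universal z _ ∷ central⇒commuting zs

  map-[,]-central : (gs : Vec Carrier n) (g : Carrier) → All Centre (Vec.map [_, g ] gs)
  map-[,]-central gs g = All.map⁺ (All.universal (λ x → central x g) gs)

  commutators-central : (gs : Vec Carrier n) → All Centre (commutators gs)
  commutators-central []       = []
  commutators-central (g ∷ gs) = All.++⁺ (map-[,]-central gs g) (commutators-central gs)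

  -- The collection process. Moving the power gˡ of the head to the left past x = `lin ks gs` costs
  -- the central factor [x, gˡ], which expands bilinearly into the commutators [gᵢ, g] with
  -- exponents l * kᵢ; these are the first block of the witness.
  lin-∙ : (ks ls : Vec ℕ n) (gs : Vec Carrier n) → ∃[ es ]
          lin ks gs ∙ lin ls gs ≈ lin (zipWith _+_ ks ls) gs ∙ lin es (commutators gs)
  lin-∙ []       []       []       = [] , refl
  lin-∙ (k ∷ ks) (l ∷ ls) (g ∷ gs) with es , eq ← lin-∙ ks ls gs =
    Vec.map (l *_) ks Vec.++ es , (begin
      (pow g k ∙ x) ∙ (pow g l ∙ y)          ≈⟨ assoc _ _ _ ⟩
      pow g k ∙ (x ∙ (pow g l ∙ y))          ≈⟨ ∙-congˡ (assoc _ _ _) ⟨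
      pow g k ∙ ((x ∙ pow g l) ∙ y)
        ≈⟨ ∙-congˡ (∙-congʳ (trans (exchange x (pow g l)) (∙-congˡ commutator-eq))) ⟩
      pow g k ∙ (((pow g l ∙ x) ∙ z) ∙ y)    ≈⟨ ∙-congˡ (assoc _ _ _) ⟩
      pow g k ∙ ((pow g l ∙ x) ∙ (z ∙ y))    ≈⟨ ∙-congˡ (assoc _ _ _) ⟩
      pow g k ∙ (pow g l ∙ (x ∙ (z ∙ y)))    ≈⟨ assoc _ _ _ ⟨
      (pow g k ∙ pow g l) ∙ (x ∙ (z ∙ y))    ≈⟨ ∙-cong (pow-+ g k l) (∙-congˡ (sym (z-central y))) ⟨
      pow g (k + l) ∙ (x ∙ (y ∙ z))          ≈⟨ ∙-congˡ (assoc _ _ _) ⟨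
      pow g (k + l) ∙ ((x ∙ y) ∙ z)          ≈⟨ ∙-congˡ (trans (∙-congʳ eq) (assoc _ _ _)) ⟩
      pow g (k + l) ∙ (xy ∙ (e ∙ z))         ≈⟨ assoc _ _ _ ⟨
      (pow g (k + l) ∙ xy) ∙ (e ∙ z)         ≈⟨ ∙-congˡ (z-central e) ⟨
      (pow g (k + l) ∙ xy) ∙ (z ∙ e)
        ≈⟨ ∙-congˡ (lin-++ (Vec.map (l *_) ks) es (Vec.map [_, g ] gs) (commutators gs)) ⟨
      (pow g (k + l) ∙ xy) ∙ lin (Vec.map (l *_) ks Vec.++ es) (commutators (g ∷ gs)) ∎)
    where
    x = lin ks gs
    y = lin ls gs
    xy = lin (zipWith _+_ ks ls) gs
    e = lin es (commutators gs)
    z = lin (Vec.map (l *_) ks) (Vec.map [_, g ] gs)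
    z-central = lin-central (Vec.map (l *_) ks) (map-[,]-central gs g)
    commutator-eq : [ x , pow g l ] ≈ z
    commutator-eq = begin
      [ x , pow g l ]                        ≈⟨ [,]-powʳ x g l ⟩
      pow [ x , g ] l                        ≈⟨ pow-cong l ([,]-linˡ ks gs g) ⟩
      pow (lin ks (Vec.map [_, g ] gs)) l    ≈⟨ lin-* l ks (central⇒commuting (map-[,]-central gs g)) ⟨
      z                                      ∎

  HasNormalForm : Vec Carrier n → Carrier → Set ℓ
  HasNormalForm gs x = ∃[ ks ] ∃[ es ] x ≈ lin ks gs ∙ lin es (commutators gs)

  module _ (gs : Vec Carrier n) where

    normalForm-∣ : ∀ x ks es → x ≈ lin ks gs ∙ lin es (commutators gs) → All (p ∣_) ks → All (p ∣_) es → x ≈ ε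
    normalForm-∣ x ks es x≈ p∣ks p∣es = trans x≈
      (trans (∙-cong (lin-∣ gs p∣ks) (lin-∣ (commutators gs) p∣es)) (identityˡ ε))

    normalForm-ε : HasNormalForm gs ε
    normalForm-ε = replicate n 0 , replicate (binomial₂ n) 0 ,
      sym (trans (∙-cong (lin-zero gs) (lin-zero (commutators gs))) (identityˡ ε))

    normalForm-∙ : ∀ {x y} → HasNormalForm gs x → HasNormalForm gs y → HasNormalForm gs (x ∙ y)
    normalForm-∙ {x} {y} (ks , ds , x≈) (ls , es , y≈) with fs , eq ← lin-∙ ks ls gs =
      zipWith _+_ ks ls , zipWith _+_ fs (zipWith _+_ ds es) , (begin
        x ∙ y                                      ≈⟨ ∙-cong x≈ y≈ ⟩
        (lin ks gs ∙ z ds) ∙ (lin ls gs ∙ z es)    ≈⟨ swap-middle _ _ (z-central ds _) ⟩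
        (lin ks gs ∙ lin ls gs) ∙ (z ds ∙ z es)    ≈⟨ ∙-congʳ eq ⟩
        (xy ∙ z fs) ∙ (z ds ∙ z es)                ≈⟨ assoc _ _ _ ⟩
        xy ∙ (z fs ∙ (z ds ∙ z es))                ≈⟨ ∙-congˡ (∙-congˡ (z-+ ds es)) ⟨
        xy ∙ (z fs ∙ z (zipWith _+_ ds es))        ≈⟨ ∙-congˡ (z-+ fs _) ⟨
        xy ∙ z (zipWith _+_ fs (zipWith _+_ ds es)) ∎)
      where
      z : Vec ℕ (binomial₂ n) → Carrier
      z ks = lin ks (commutators gs)
      xy = lin (zipWith _+_ ks ls) gs
      z-central : ∀ ks → Centre (z ks)
      z-central ks = lin-central ks (commutators-central gs)
      z-+ : ∀ ks ls → z (zipWith _+_ ks ls) ≈ z ks ∙ z ls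
      z-+ ks ls = lin-+ ks ls (central⇒commuting (commutators-central gs))

    normalForm-resp : ∀ {x y} → x ≈ y → HasNormalForm gs x → HasNormalForm gs y
    normalForm-resp x≈y (ks , es , eq) = ks , es , trans (sym x≈y) eq

    -- An inverse is a power, so closure under products suffices.
    normalForm-⁻¹ : ∀ {x} → HasNormalForm gs x → HasNormalForm gs (x ⁻¹)
    normalForm-⁻¹ {x} nf = normalForm-resp (pow-p∸1 x) (normalForm-pow (p ∸ 1))
      where
      normalForm-pow : ∀ k → HasNormalForm gs (pow x k)
      normalForm-pow zero    = normalForm-ε
      normalForm-pow (suc k) = normalForm-∙ nf (normalForm-pow k)

  lookup-lin : (gs : Vec Carrier n) (i : Fin n) → ∃[ ks ] lin ks gs ≈ lookup gs i
  lookup-lin (g ∷ gs) zero    = 1 ∷ replicate _ 0 ,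
    trans (∙-cong (identityʳ g) (lin-zero gs)) (identityʳ g)
  lookup-lin (g ∷ gs) (suc i) with ks , eq ← lookup-lin gs i = 0 ∷ ks , trans (identityˡ _) eq

  normalForm-lookup : (gs : Vec Carrier n) (i : Fin n) → HasNormalForm gs (lookup gs i)
  normalForm-lookup gs i with ks , eq ← lookup-lin gs i = ks , replicate _ 0 ,
    sym (trans (∙-cong eq (lin-zero (commutators gs))) (identityʳ _))

  -- Such a product is trivial only if lin ks gs is central, and its commutators
  -- with the members of gs give the divisibility of ks.
  normalForm-unique : (gs : Vec Carrier n) → 2 ≤ n → Independent (commutators gs) →
                      ∀ ks es → lin ks gs ∙ lin es (commutators gs) ≈ ε → All (p ∣_) ks × All (p ∣_) es
  normalForm-unique (g ∷ h ∷ gs) (s≤s (s≤s z≤n)) indep (k ∷ ks) es eq = p∣k ∷ p∣ks , indep es (begin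
    z                ≈⟨ identityˡ z ⟨
    ε ∙ z            ≈⟨ ∙-congʳ (lin-∣ (g ∷ h ∷ gs) (p∣k ∷ p∣ks)) ⟨
    x ∙ z            ≈⟨ eq ⟩
    ε                ∎)
    where
    x = lin (k ∷ ks) (g ∷ h ∷ gs)
    z = lin es (commutators (g ∷ h ∷ gs))

    [x,]≈ε : ∀ y → [ x , y ] ≈ ε
    [x,]≈ε y = begin
      [ x , y ]                ≈⟨ identityʳ _ ⟨
      [ x , y ] ∙ ε
        ≈⟨ ∙-congˡ (commute⇒[,]≈ε (lin-central es (commutators-central (g ∷ h ∷ gs)) y)) ⟨
      [ x , y ] ∙ [ z , y ]    ≈⟨ [,]-∙ˡ x z y ⟨
      [ x ∙ z , y ]            ≈⟨ [,]-cong eq refl ⟩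
      [ ε , y ]                ≈⟨ [ε,] y ⟩
      ε                        ∎

    -- The commutator with g eliminates the coefficient of g itself and leaves a relation among the
    -- [gᵢ, g] with coefficients `ks`.
    p∣ks : All (p ∣_) ks
    p∣ks = All.++ˡ⁻ ks (indep (ks Vec.++ replicate _ 0) (begin
      lin (ks Vec.++ replicate _ 0) (commutators (g ∷ h ∷ gs))
        ≈⟨ lin-++ ks (replicate _ 0) (Vec.map [_, g ] (h ∷ gs)) (commutators (h ∷ gs)) ⟩
      lin ks (Vec.map [_, g ] (h ∷ gs)) ∙ lin (replicate _ 0) (commutators (h ∷ gs))
        ≈⟨ ∙-cong (sym ([,]-linˡ ks (h ∷ gs) g)) (lin-zero (commutators (h ∷ gs))) ⟩
      [ lin ks (h ∷ gs) , g ] ∙ ε                          ≈⟨ identityʳ _ ⟩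
      [ lin ks (h ∷ gs) , g ]                              ≈⟨ identityˡ _ ⟨
      ε ∙ [ lin ks (h ∷ gs) , g ]                          ≈⟨ ∙-congʳ (commute⇒[,]≈ε (sym (commute-pow k refl))) ⟨
      [ pow g k , g ] ∙ [ lin ks (h ∷ gs) , g ]            ≈⟨ [,]-∙ˡ _ _ g ⟨
      [ x , g ]                                            ≈⟨ [x,]≈ε g ⟩
      ε                                                    ∎))

    x≈gᵏ : x ≈ pow g k
    x≈gᵏ = trans (∙-congˡ (lin-∣ (h ∷ gs) p∣ks)) (identityʳ _)

    -- Only the power of g remains; its commutator with the second element h detects k. This is
    -- where two generators are required.
    p∣k : p ∣ k
    p∣k = All.head (indep (k ∷ replicate _ 0) (begin
      pow [ h , g ] k ∙ lin (replicate _ 0) (Vec.map [_, g ] gs Vec.++ commutators (h ∷ gs))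
        ≈⟨ ∙-congˡ (lin-zero (Vec.map [_, g ] gs Vec.++ commutators (h ∷ gs))) ⟩
      pow [ h , g ] k ∙ ε        ≈⟨ identityʳ _ ⟩
      pow [ h , g ] k            ≈⟨ [,]-powʳ h g k ⟨
      [ h , pow g k ]            ≈⟨ [,]-cong refl x≈gᵏ ⟨
      [ h , x ]                  ≈⟨ commute⇒[,]≈ε (sym ([,]≈ε⇒commute ([x,]≈ε h))) ⟩
      ε                          ∎))

-- Independent commutators generate a relatively free subgroup

module FreeSubgroup (G : Group c ℓ) (central : ∀ x y → GroupTheory.Centre G (GroupTheory.[_,_] G x y))
                    {p : ℕ} (p-prime : Prime p) (pow-p : ∀ g → Group._≈_ G (Powers.pow G g p) (Group.ε G))
                    {t : ℕ} (gs : Vec (Group.Carrier G) t) where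
  open Group G
  open GroupProperties G
  open GroupTheory G using ([,]-cong; [_,_])
  open Commutators G using (commutators; commute⇒[,]≈ε)
  open Powers G
  open Exponent G p-prime pow-p using (Independent)
  private
    module F = Free (Fin t)
    module R = NormalSubgroup (GroupTheory.classTwoExponentSubgroup (FreeGroup (Fin t)) p)
    module PF = Powers (FreeGroup (Fin t))
    Q = F[ p ,2, t ]
    module Q = Group Q

  eval : F.Term → Carrier
  eval (F.var i) = lookup gs i
  eval F.ε       = ε
  eval (x F.∙ y) = eval x ∙ eval y
  eval (x F.⁻¹)  = eval x ⁻¹

  eval-cong : ∀ {x y} → x F.≈ y → eval x ≈ eval y
  eval-cong F.refl            = refl
  eval-cong (F.sym p)         = sym (eval-cong p)
  eval-cong (F.trans p q)     = trans (eval-cong p) (eval-cong q)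
  eval-cong (F.∙-cong p q)    = ∙-cong (eval-cong p) (eval-cong q)
  eval-cong (F.⁻¹-cong p)     = ⁻¹-cong (eval-cong p)
  eval-cong (F.assoc x y z)   = assoc _ _ _
  eval-cong (F.identityˡ x)   = identityˡ _
  eval-cong (F.identityʳ x)   = identityʳ _
  eval-cong (F.inverseˡ x)    = inverseˡ _
  eval-cong (F.inverseʳ x)    = inverseʳ _

  eval-pow : ∀ x k → eval (PF.pow x k) ≡ pow (eval x) k
  eval-pow x zero    = ≡.refl
  eval-pow x (suc k) = cong (eval x ∙_) (eval-pow x k)

  eval-relator : ∀ {w} → R.Mem w → eval w ≈ ε
  eval-relator (gen (inj₁ (x , eq))) = trans (eval-cong eq)
    (trans (reflexive (≡.trans (cong eval (≡.sym (PF.pow≡^ x p))) (eval-pow x p))) (pow-p (eval x)))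
  eval-relator (gen (inj₂ (x , y , z , eq))) = trans (eval-cong eq)
    (commute⇒[,]≈ε (central (eval x) (eval y) (eval z)))
  eval-relator (resp x≈y x∈) = trans (sym (eval-cong x≈y)) (eval-relator x∈)
  eval-relator unit          = refl
  eval-relator (mul x∈ y∈)   = trans (∙-cong (eval-relator x∈) (eval-relator y∈)) (identityˡ ε)
  eval-relator (inv x∈)      = trans (⁻¹-cong (eval-relator x∈)) ε⁻¹≈ε

  eval-resp-∼ : ∀ x y → x Q.≈ y → eval x ≈ eval y
  eval-resp-∼ x y x∼y = x∙y⁻¹≈ε⇒x≈y (eval x) (eval y) (eval-relator x∼y)

  relator : ∀ {w} → R.Mem w → w Q.≈ Q.ε
  relator = R.resp (F.sym (F.trans
    (F.∙-cong F.refl (GroupProperties.ε⁻¹≈ε (FreeGroup (Fin t)))) (F.identityʳ _)))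

  Q-central : ∀ x y → GroupTheory.Centre Q (GroupTheory.[_,_] Q x y)
  Q-central x y z = Commutators.[,]≈ε⇒commute Q {GroupTheory.[_,_] Q x y} {z}
    (relator (gen (inj₂ (x , y , z , F.refl))))

  Q-pow-p : ∀ x → Powers.pow Q x p Q.≈ Q.ε
  Q-pow-p x = relator (gen (inj₁ (x , reflexive-F (PF.pow≡^ x p))))
    where
    reflexive-F : ∀ {x y} → x ≡ y → x F.≈ y
    reflexive-F ≡.refl = F.refl

  private
    vars : Vec F.Term t
    vars = tabulate F.var

    module NF = NormalForm Q Q-central p-prime Q-pow-p
    module CQ = Commutators Q
    module PQ = Powers Q

  normalForm : ∀ w → NF.HasNormalForm vars w
  normalForm (F.var i) = subst (NF.HasNormalForm vars) (lookup∘tabulate F.var i) (NF.normalForm-lookup vars i)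
  normalForm F.ε       = NF.normalForm-ε vars
  normalForm (x F.∙ y) = NF.normalForm-∙ vars (normalForm x) (normalForm y)
  normalForm (x F.⁻¹)  = NF.normalForm-⁻¹ vars (normalForm x)

  eval-lin : (ks : Vec ℕ n) (ws : Vec F.Term n) → eval (PQ.lin ks ws) ≡ lin ks (Vec.map eval ws)
  eval-lin []       []       = ≡.refl
  eval-lin (k ∷ ks) (w ∷ ws) = cong₂ _∙_ (eval-pow w k) (eval-lin ks ws)

  eval-commutators : (ws : Vec F.Term n) → Vec.map eval (CQ.commutators ws) ≡ commutators (Vec.map eval ws)
  eval-commutators []       = ≡.refl
  eval-commutators (w ∷ ws) = ≡.trans (map-++ eval _ (CQ.commutators ws)) (cong₂ Vec._++_
    (≡.trans (≡.sym (map-∘ eval _ ws)) (map-∘ [_, eval w ] eval ws)) (eval-commutators ws))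

  eval-vars : Vec.map eval vars ≡ gs
  eval-vars = ≡.trans (≡.sym (tabulate-∘ eval F.var)) (tabulate∘lookup gs)

  -- Modulo the relators w equals a normal form. If its value in G is trivial, uniqueness of normal
  -- forms in G makes all exponents divisible by p, and then the normal form is trivial in the
  -- relatively free group too.
  eval-injective : 2 ≤ t → Independent (commutators gs) → ∀ w → eval w ≈ ε → w Q.≈ Q.ε
  eval-injective 2≤t indep w w≈ε = NF.normalForm-∣ vars w ks es w∼nf (proj₁ p∣) (proj₂ p∣)
    where
    ks = proj₁ (normalForm w)
    es = proj₁ (proj₂ (normalForm w))
    w∼nf = proj₂ (proj₂ (normalForm w))
    nf = PQ.lin ks vars F.∙ PQ.lin es (CQ.commutators vars)

    eval-nf : eval nf ≡ lin ks gs ∙ lin es (commutators gs)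
    eval-nf = cong₂ _∙_
      (≡.trans (eval-lin ks vars) (cong (lin ks) eval-vars))
      (≡.trans (eval-lin es (CQ.commutators vars))
        (cong (lin es) (≡.trans (eval-commutators vars) (cong commutators eval-vars))))

    p∣ : All (p ∣_) ks × All (p ∣_) es
    p∣ = NormalForm.normalForm-unique G central p-prime pow-p gs 2≤t indep ks es
      (trans (reflexive (≡.sym eval-nf)) (trans (sym (eval-resp-∼ w nf w∼nf)) w≈ε))

  -- Given as the image of `eval`, so that a membership proof carries the word that the isomorphism
  -- returns; `Lift` only adjusts the level.
  generated : Subgroup G (c ⊔ ℓ)
  generated = record
    { Mem       = λ g → Lift c (∃[ w ] eval w ≈ g)
    ; resp      = λ { g≈h (lift (w , eq)) → lift (w , trans eq g≈h) }
    ; ε-closed  = lift (F.ε , refl)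
    ; ∙-closed  = λ { (lift (v , p)) (lift (w , q)) → lift (v F.∙ w , ∙-cong p q) }
    ; ⁻¹-closed = λ { (lift (w , p)) → lift (w F.⁻¹ , ⁻¹-cong p) }
    }

  generated-free : 2 ≤ t → Independent (commutators gs) → ⌊ generated ⌋ ≅ Q
  generated-free 2≤t indep = term , record
    { isGroupMonomorphism = record
      { isGroupHomomorphism = record
        { isMonoidHomomorphism = record
          { isMagmaHomomorphism = record
            { isRelHomomorphism = record { cong = λ {x} {y} → term-cong {x} {y} }
            ; homo = λ { (_ , lift (v , _)) (_ , lift (w , _)) → Q.refl {v F.∙ w} }
            }
          ; ε-homo = Q.refl {Q.ε}
          }
        ; ⁻¹-homo = λ { (_ , lift (w , _)) → Q.refl {w F.⁻¹} }
        }
      ; injective = λ {x} {y} → term-injective {x} {y}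
      }
    ; surjective = λ w → (eval w , lift (w , refl)) , λ {z} eq → term-cong {z} {eval w , lift (w , refl)} eq
    }
    where
    term : Group.Carrier ⌊ generated ⌋ → F.Term
    term (_ , lift (w , _)) = w

    term-cong : ∀ {x y} → proj₁ x ≈ proj₁ y → term x Q.≈ term y
    term-cong {g , lift (v , p)} {h , lift (w , q)} g≈h = R.resp
      (F.trans (F.∙-cong F.refl (GroupProperties.ε⁻¹≈ε (FreeGroup (Fin t)))) (F.identityʳ _))
      (eval-injective 2≤t indep (v F.∙ w F.⁻¹) (x≈y⇒x∙y⁻¹≈ε (trans p (trans g≈h (sym q)))))

    term-injective : ∀ {x y} → term x Q.≈ term y → proj₁ x ≈ proj₁ y
    term-injective {g , lift (v , p)} {h , lift (w , q)} v∼w =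
      trans (sym p) (trans (eval-resp-∼ v w v∼w) q)

-- Commuting independent elements span a copy of ℤ_p^s

module _ (G : Group c ℓ) {p : ℕ} (p-prime : Prime p)
         (pow-p : ∀ g → Group._≈_ G (Powers.pow G g p) (Group.ε G)) where
  open Group G
  open Powers G
  open Exponent G p-prime pow-p
  open SetoidReasoning setoid
  private instance
    p≢0 : NonZero p
    p≢0 = prime⇒nonZero p-prime

  lin-cong-% : (ks ls : Vec ℕ n) (gs : Vec Carrier n) →
               (∀ i → lookup ks i % p ≡ lookup ls i % p) → lin ks gs ≈ lin ls gs
  lin-cong-% []       []       []       eq = refl
  lin-cong-% (k ∷ ks) (l ∷ ls) (g ∷ gs) eq = ∙-cong
    (trans (sym (pow-% g k)) (trans (reflexive (cong (pow g) (eq zero))) (pow-% g l)))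
    (lin-cong-% ks ls gs (eq ∘ suc))

  lin-injective-% : {gs : Vec Carrier n} → AllPairs Commute gs → Independent gs →
                    (ks ls : Vec ℕ n) → lin ks gs ≈ lin ls gs → ∀ i → lookup ks i % p ≡ lookup ls i % p
  -- Subtraction is avoided: k + (p - 1)l is divisible by p by independence, and adding l to it
  -- gives k + lp.
  lin-injective-% {gs = gs} comm indep ks ls eq i = ≡.trans (≡.sym ([m+kn]%n≡m%n k l p))
    (≡.trans (cong (_% p) regroup) (%-remove-+ˡ l p∣k+[p-1]l))
    where
    ms : Vec ℕ _
    ms = Vec.map ((p ∸ 1) *_) ls

    p∣ks+ms : All (p ∣_) (zipWith _+_ ks ms)
    p∣ks+ms = indep (zipWith _+_ ks ms) (begin
      lin (zipWith _+_ ks ms) gs    ≈⟨ lin-+ ks ms comm ⟩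
      lin ks gs ∙ lin ms gs         ≈⟨ ∙-cong eq (lin-p∸1 ls comm) ⟩
      lin ls gs ∙ lin ls gs ⁻¹      ≈⟨ inverseʳ _ ⟩
      ε                             ∎)

    k = lookup ks i
    l = lookup ls i

    p∣k+[p-1]l : p ∣ k + (p ∸ 1) * l
    p∣k+[p-1]l = subst (p ∣_)
      (≡.trans (lookup-zipWith _+_ i ks ms) (cong (lookup ks i +_) (lookup-map i ((p ∸ 1) *_) ls)))
      (All.lookup⁺ p∣ks+ms i)

    regroup : k + l * p ≡ (k + (p ∸ 1) * l) + l
    regroup = ≡.trans (cong (k +_) (≡.trans (ℕ.*-comm l p)
      (≡.trans (cong (_* l) (≡.sym (ℕ.suc-pred p))) (ℕ.+-comm l _))))
      (≡.sym (ℕ.+-assoc k _ l))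

module IsotropicSubgroup
  (G : Group c ℓ) {p : ℕ} (p-prime : Prime p)
  (pow-p : ∀ g → Group._≈_ G (Powers.pow G g p) (Group.ε G))
  {s : ℕ} (gs : Vec (Group.Carrier G) s) (commuting : AllPairs (Powers.Commute G) gs) where
  open Group G
  open GroupProperties G
  open Powers G
  open Exponent G p-prime pow-p
  open GroupTheory G using (derived)
  private
    A = G / derived
    module A = Group A
    module D = NormalSubgroup derived
    instance
      p≢0 : NonZero p
      p≢0 = prime⇒nonZero p-prime

  combinations : Subgroup G (c ⊔ ℓ)
  combinations = record
    { Mem       = λ g → Lift c (∃[ ks ] g ≈ lin ks gs)
    ; resp      = λ { g≈h (lift (ks , eq)) → lift (ks , trans (sym g≈h) eq) }
    ; ε-closed  = lift (replicate s 0 , sym (lin-zero gs))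
    ; ∙-closed  = λ { (lift (ks , eq)) (lift (ls , eq′)) →
        lift (zipWith _+_ ks ls , trans (∙-cong eq eq′) (sym (lin-+ ks ls commuting))) }
    ; ⁻¹-closed = λ { (lift (ks , eq)) →
        lift (Vec.map ((p ∸ 1) *_) ks , trans (⁻¹-cong eq) (sym (lin-p∸1 ks commuting))) }
    }

  combinations-abelian : Abelian ⌊ combinations ⌋
  combinations-abelian (x , lift (ks , x≈)) (y , lift (ls , y≈)) = begin
    x ∙ y                        ≈⟨ ∙-cong x≈ y≈ ⟩
    lin ks gs ∙ lin ls gs        ≈⟨ lin-+ ks ls commuting ⟨
    lin (zipWith _+_ ks ls) gs   ≡⟨ cong (λ ms → lin ms gs) (zipWith-comm ℕ.+-comm ks ls) ⟩
    lin (zipWith _+_ ls ks) gs   ≈⟨ lin-+ ls ks commuting ⟩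
    lin ls gs ∙ lin ks gs        ≈⟨ ∙-cong y≈ x≈ ⟨
    y ∙ x                        ∎
    where
    open SetoidReasoning (Group.setoid G)

  -- An element of S[G,G] carries a decomposition hk with coefficients for h, and these are its
  -- coordinates. Neither choice is unique, but independence modulo [G,G] determines the
  -- coefficients modulo p.
  combinations-≅ : (∀ ks → lin ks gs A.≈ ε → All (p ∣_) ks) → combinations [G,G]/[G,G] ≅ (ℤ/ p ^ᴳ s)
  combinations-≅ indep = coordinates , record
    { isGroupMonomorphism = record
      { isGroupHomomorphism = record
        { isMonoidHomomorphism = record
          { isMagmaHomomorphism = record
            { isRelHomomorphism = record { cong = λ {x} {y} → coordinates-cong {x} {y} }
            ; homo = λ { (_ , _ , _ , lift (ks , _) , _) (_ , _ , _ , lift (ls , _) , _) i →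
                ℤ/p.reflexive (≡.trans (cong ℤ.+_ (lookup-zipWith _+_ i ks ls))
                  (ℤ.pos-+ (lookup ks i) (lookup ls i))) }
            }
          ; ε-homo = λ i → ℤ/p.reflexive (cong ℤ.+_ (lookup-replicate i 0))
          }
        ; ⁻¹-homo = λ { (_ , _ , _ , lift (ks , _) , _) i → negate ks i }
        }
      ; injective = λ {x} {y} → coordinates-injective {x} {y}
      }
    ; surjective = λ z → preimage z , λ {x} → coordinates-preimage z {x}
    }
    where
    open Residue p
    module ℤ/p = Group (ℤ/ p)
    open SetoidReasoning A.setoid
    B = ⌊ combinations · derived ⌋
    module B = Group B

    coefficients : B.Carrier → Vec ℕ s
    coefficients (_ , _ , _ , lift (ks , _) , _) = ks

    coordinates : B.Carrier → Fin s → ℤ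
    coordinates x i = ℤ.+ lookup (coefficients x) i

    ∼-lin : ∀ x → proj₁ x A.≈ lin (coefficients x) gs
    ∼-lin (x , h , k , lift (ks , h≈) , k∈ , x≈hk) = begin
      x                  ≈⟨ Quotient.≈⇒∼ derived x≈hk ⟩
      h ∙ k              ≈⟨ A.∙-cong {h} {lin ks gs} {k} {ε} (Quotient.≈⇒∼ derived h≈) k∼ε ⟩
      lin ks gs ∙ ε      ≈⟨ A.identityʳ (lin ks gs) ⟩
      lin ks gs          ∎
      where
      k∼ε : k A.≈ ε
      k∼ε = D.resp (sym (trans (∙-congˡ ε⁻¹≈ε) (identityʳ k))) k∈

    coordinates-cong : ∀ {x y} → proj₁ x A.≈ proj₁ y → ∀ i → coordinates x i ℤ/p.≈ coordinates y i
    coordinates-cong {x} {y} x∼y i = %≡⇒≈ (coordinates x i) (coordinates y i)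
      (lin-injective-% A p-prime (λ g → Quotient.≈⇒∼ derived (pow-p g))
        {gs = gs} A-commuting indep (coefficients x) (coefficients y) lin∼ i)
      where
      A-commuting : AllPairs (Powers.Commute A) gs
      A-commuting = AllPairs.map (Quotient.≈⇒∼ derived) commuting
      lin∼ : lin (coefficients x) gs A.≈ lin (coefficients y) gs
      lin∼ = begin
        lin (coefficients x) gs   ≈⟨ ∼-lin x ⟨
        proj₁ x                   ≈⟨ x∼y ⟩
        proj₁ y                   ≈⟨ ∼-lin y ⟩
        lin (coefficients y) gs   ∎

    coordinates-injective : ∀ {x y} → (∀ i → coordinates x i ℤ/p.≈ coordinates y i) → proj₁ x A.≈ proj₁ y
    coordinates-injective {x} {y} eq = begin
      proj₁ x                   ≈⟨ ∼-lin x ⟩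
      lin (coefficients x) gs   ≈⟨ Quotient.≈⇒∼ derived (lin-cong-% G p-prime pow-p (coefficients x) (coefficients y) gs
                                    (λ i → ≈⇒%≡ (coordinates x i) (coordinates y i) (eq i))) ⟩
      lin (coefficients y) gs   ≈⟨ ∼-lin y ⟨
      proj₁ y                   ∎

    preimage : (Fin s → ℤ) → B.Carrier
    preimage z = lin ks gs , lin ks gs , ε , lift (ks , refl) , D.ε-closed , sym (identityʳ _)
      where ks = tabulate (λ i → z i ℤ.%ℕ p)

    coordinates-preimage : ∀ z {x} → proj₁ x A.≈ proj₁ (preimage z) → ∀ i → coordinates x i ℤ/p.≈ z i
    coordinates-preimage z {x} x∼ i = %≡⇒≈ (coordinates x i) (z i) (≡.trans
      (≈⇒%≡ (coordinates x i) (coordinates (preimage z) i) (coordinates-cong {x} {preimage z} x∼ i))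
      (≡.trans (cong (_% p) (lookup∘tabulate (λ i → z i ℤ.%ℕ p) i)) (ℕ.m<n⇒m%n≡m (ℤ.n%ℕd<d (z i) p))))

    negate : ∀ ks i → ℤ.+ lookup (Vec.map ((p ∸ 1) *_) ks) i ℤ/p.≈ ℤ.- (ℤ.+ lookup ks i)
    negate ks i = ℤ∣.divides (ℤ.+ k) (≡.trans
      (cong₂ ℤ._+_ (cong ℤ.+_ (lookup-map i ((p ∸ 1) *_) ks)) (ℤ.neg-involutive (ℤ.+ k)))
      (≡.trans (≡.sym (ℤ.pos-+ ((p ∸ 1) * k) k)) (≡.trans (cong ℤ.+_ regroup) (ℤ.pos-* k p))))
      where
      k = lookup ks i
      regroup : (p ∸ 1) * k + k ≡ k * p
      regroup = ≡.trans (ℕ.+-comm _ k) (≡.trans (cong (_* k) (ℕ.suc-pred p)) (ℕ.*-comm p k))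

-- Arithmetic of the bound and conclusion

odd-prime>2 : ∀ {p} → Prime p → ¬ (2 ∣ p) → 2 < p
odd-prime>2 p-prime 2∤p = ℕ.≤∧≢⇒< (ℕ.nonTrivial⇒n>1 _ {{prime⇒nonTrivial p-prime}}) λ { ≡.refl → 2∤p ∣-refl }

-- Since 2d + 1 = t² - t + 3, the assumption t ≥ 2 gives 2d + 1 ≤ t² + 1, and 4 ≤ t² leaves ample
-- room below t⁴.
3+2*binomial₂≤t⁴ : ∀ t → 2 ≤ t → let d = suc (binomial₂ t) in suc (d + d) ≤ t ^ℕ 4
3+2*binomial₂≤t⁴ t 2≤t = begin
  suc (d + d)                            ≡⟨ expand (binomial₂ t) ⟩
  1 + ((binomial₂ t + binomial₂ t) + 2)  ≤⟨ ℕ.+-monoʳ-≤ 1 (ℕ.+-monoʳ-≤ (binomial₂ t + binomial₂ t) 2≤t) ⟩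
  1 + ((binomial₂ t + binomial₂ t) + t)  ≡⟨ cong (1 +_) (2*binomial₂+n t) ⟩
  1 + t * t                              ≤⟨ ℕ.+-monoˡ-≤ (t * t) (ℕ.≤-trans (s≤s z≤n) 4≤t*t) ⟩
  t * t + t * t                          ≤⟨ ℕ.+-monoʳ-≤ (t * t) (ℕ.m≤m+n (t * t) _) ⟩
  4 * (t * t)                            ≤⟨ ℕ.*-monoˡ-≤ (t * t) 4≤t*t ⟩
  (t * t) * (t * t)                      ≡⟨ fourth t ⟩
  t ^ℕ 4                                 ∎
  where
  open ℕ.≤-Reasoning
  d = suc (binomial₂ t)
  4≤t*t : 4 ≤ t * t
  4≤t*t = ℕ.*-mono-≤ 2≤t 2≤t
  expand : ∀ b → suc (suc b + suc b) ≡ 1 + ((b + b) + 2)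
  expand = solve-∀
  fourth : ∀ t → (t * t) * (t * t) ≡ t * (t * (t * (t * 1)))
  fourth = solve-∀

module DerivedQuotient {c ℓ} (G : Group c ℓ)
  (derived⊆Z : ∀ {z} → NormalSubgroup.Mem (GroupTheory.derived G) z → GroupTheory.Centre G z) where
  open Group G
  open GroupProperties G
  open Quotient (GroupTheory.derived G) using (_∼_)

  central : ∀ x y → GroupTheory.Centre G (GroupTheory.[_,_] G x y)
  central x y = derived⊆Z (gen (x , y , refl))

  open ClassTwo G central
  open SetoidReasoning setoid

  ∼-comm : ∀ x y → (x ∙ y) ∼ (y ∙ x)
  ∼-comm x y = resp (∙-congʳ (sym (exchange x y)))
    (NormalSubgroup.normal (GroupTheory.derived G) (y ∙ x) (gen (x , y , refl)))

  -- A factor from the derived subgroup is central and drops out by bilinearity, so the commutator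
  -- is well defined on the quotient.
  [,]-∼ˡ : ∀ {x y} z → x ∼ y → [ x , z ] ≈ [ y , z ]
  [,]-∼ˡ {x} {y} z x∼y = begin
    [ x , z ]                      ≈⟨ [,]-cong (//-rightDividesˡ y x) refl ⟨
    [ x ∙ y ⁻¹ ∙ y , z ]           ≈⟨ [,]-∙ˡ (x ∙ y ⁻¹) y z ⟩
    [ x ∙ y ⁻¹ , z ] ∙ [ y , z ]   ≈⟨ ∙-congʳ (commute⇒[,]≈ε (derived⊆Z x∼y z)) ⟩
    ε ∙ [ y , z ]                  ≈⟨ identityˡ _ ⟩
    [ y , z ]                      ∎

  [,]-∼ʳ : ∀ {x y} z → x ∼ y → [ z , x ] ≈ [ z , y ]
  [,]-∼ʳ {x} {y} z x∼y = begin
    [ z , x ]                      ≈⟨ [,]-cong refl (//-rightDividesˡ y x) ⟨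
    [ z , x ∙ y ⁻¹ ∙ y ]           ≈⟨ [,]-∙ʳ z (x ∙ y ⁻¹) y ⟩
    [ z , x ∙ y ⁻¹ ] ∙ [ z , y ]   ≈⟨ ∙-congʳ (commute⇒[,]≈ε (sym (derived⊆Z x∼y z))) ⟩
    ε ∙ [ z , y ]                  ≈⟨ identityˡ _ ⟩
    [ z , y ]                      ∎

corollary4p2 : {c ℓ : Level} (p : ℕ) → Prime p → ¬ (2 ∣ p) →
    (s t n : ℕ) → s ≥ 2 → t ≥ 2 → n ≥ s * t ^ℕ 4 →
    (G : Group c ℓ) → 𝔅ₙ p n G →
    (Σ[ S ∈ Subgroup G (c ⊔ ℓ) ]
    Abelian ⌊ S ⌋ × (S [G,G]/[G,G] ≅ (ℤ/ p ^ᴳ s)))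
    ⊎ (Σ[ H ∈ Subgroup G (c ⊔ ℓ) ] (⌊ H ⌋ ≅ F[ p ,2, t ]))
corollary4p2 p p-prime 2∤p s t n s≥2 t≥2 n≥st⁴ G B =
  [ (λ F → inj₁ (abelian-subgroup F)) , (λ F → inj₂ (free-subgroup F)) ]′
  (isotropic-or-complete (odd-prime>2 p-prime 2∤p) s t (begin
    suc (d + d) * s    ≤⟨ ℕ.*-monoˡ-≤ s (3+2*binomial₂≤t⁴ t t≥2) ⟩
    t ^ℕ 4 * s         ≡⟨ ℕ.*-comm (t ^ℕ 4) s ⟩
    s * t ^ℕ 4         ≤⟨ n≥st⁴ ⟩
    n                  ∎))
  where
  open ℕ.≤-Reasoning
  open 𝔅ₙ B
  open 𝔅 in-𝔅
  open DerivedQuotient G derived⊆Z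

  instance
    p≢0 : NonZero p
    p≢0 = prime⇒nonZero p-prime

  d : ℕ
  d = suc (binomial₂ t)

  pow-p : ∀ g → Group._≈_ G (Powers.pow G g p) (Group.ε G)
  pow-p g = Group.trans G (Group.reflexive G (Powers.pow≡^ G g p)) (exponent g)

  open Extraction G central p-prime pow-p (Counting._≈?_ (Group.setoid G) (proj₂ finite))
    (Group.isGroup (G / GroupTheory.derived G)) ∼-comm (Quotient.≈⇒∼ (GroupTheory.derived G))
    [,]-∼ˡ [,]-∼ʳ n (finite-elementary {G = G / GroupTheory.derived G} p n abelianisation)

  abelian-subgroup : ∀ {K} → IsotropicFamily K s →
                     Σ[ S ∈ Subgroup G _ ] Abelian ⌊ S ⌋ × (S [G,G]/[G,G] ≅ (ℤ/ p ^ᴳ s))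
  abelian-subgroup F = combinations , combinations-abelian , combinations-≅ (IsotropicFamily.independent F)
    where
    open IsotropicSubgroup G p-prime pow-p (IsotropicFamily.elements F) (IsotropicFamily.commuting F)

  free-subgroup : ∀ {k} → CompleteFamily k t → Σ[ H ∈ Subgroup G _ ] (⌊ H ⌋ ≅ F[ p ,2, t ])
  free-subgroup F = generated , generated-free t≥2 (CompleteFamily.independent F)
    where
    open FreeSubgroup G central p-prime pow-p (CompleteFamily.elements F)
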